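{- Every LP-USO of a grid arises from some discounted MDP. More precisely, let $M\in\mathbb R^{m\times n}$ be a block matrix of type $b\in\mathbb N^n$, $q\in\mathbb R^m$, $p\in\mathbb R^n$ be such that $\min q^Tu$ subject to $M^Tu\le p$, $u\ge\mathbf 0$ is a (dual nondegenerate) Grid-LP. Then the USO of $G(b+\mathbf 1)$ arising from it also arises from the discounted MDP $$\max\; -[q^TL\,|\,\mathbf 0]\,y\quad\text{subject to}\quad [Y^TL\,|\,X^TH^{ -1}]\,y=X^Tp,\; y\ge\mathbf 0,$$ where $(X,Y)$ is a proper hidden K-witness of $M$, and $L\in\mathbb R^{m\times m}$, $H\in\mathbb R^{n\times n}$ are positive diagonal matrices such that $[LY|H^{ -1}X]$ is a stochastic K-matrix.
   Context: Write $[n]=\{1,\dots,n\}$; $\mathbf 1$ is the all-ones vector. A block matrix of type $b=(b_1,\dots,b_n)$ ($b_j$ positive integers) is a real $m\times n$ matrix, $m=\sum_jb_j$, whose rows are partitioned into $n$ consecutive blocks, block $j$ having $b_j$ rows; rows are indexed by $N(b)=\{(j,i): j\in[n], i\in[b_j]\}$. For an $n\times n$ matrix $X$, $[M|X]$ is the block matrix of type $b+\mathbf 1$ obtained by appending the $j$-th row of $X$ as last row (index $(j,b_j+1)$) of block $j$; analogous notation is used for block vectors and for columns of transposed matrices, e.g. $[M^T|I]$ has columns indexed by $N(b+\mathbf 1)$ and $[Y^TL|X^TH^{ -1}]=[LY|H^{ -1}X]^T$, and $[q^TL|\mathbf 0]$ has entry $0$ at each $(j,b_j+1)$. $B\subseteq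 N(b)$ is maximal complementary if it contains exactly one $(j,i)$ for each $j$; then the $n\times n$ matrix $M_B$ of rows in $B$ is a representative submatrix. A square Z-matrix has nonpositive off-diagonal entries; a block Z-matrix is one whose every representative submatrix is a square Z-matrix. A proper hidden K-witness of $M$ of type $b$ is a pair $(X,Y)$ with $X\in\mathbb R^{n\times n}$ a square Z-matrix, $Y$ a block Z-matrix of type $b$, $MX=Y$ and $[Y|X]\mathbf 1>\mathbf 0$. (The matrix of a Grid-LP has a proper hidden K-witness, and $L,H$ as described exist.) A stochastic K-matrix is a block matrix for which there is $\gamma\in[0,1)$ such that every representative submatrix is $I-\gamma S$ with $S\ge\mathbf 0$, $S\mathbf 1=\mathbf 1$. The grid $G(b)$ is the graph whose vertices are the maximal complementary subsets of $N(b)$, two being adjacent if they differ in exactly one element. A subgrid is the subgraph induced by the vertices contained in some subset of $N(b)$. A unique-sink orientation (USO) is an orientation of the edges such that every (nonempty) subgrid has a unique sink. Grid-LP: an LP $\min q^Tu$ s.t. $M^Tu\le p$, $u\ge\mathbf 0$ such that, with $A=[M^T|I]$, $A_B$ (columns in $B$) is nonsingular with $A_B^{ -1}p>\mathbf 0$ for every maximal complementary $B\subseteq N(b+\mathbf 1)$. With $c=[q|\mathbf 0]$, the USO arising from it is the orientation of $G(b+\mathbf 1)$ in which, for adjacent $B$ and $C=(B\setminus\{(j,i)\})\cup\{(j,k)\}$, $B\to C$ iff $(c_N^T-c_B^TA_B^{ -1}A_N)^j_k<0$, $N=N(b+\mathbf 1)\setminus B$; dual nondegenerate means none of these entries is zero.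 An LP-USO is a USO arising in this way. A discounted MDP with $n$ states, $a_j$ actions in state $j$, rewards $r=(r^j_i)$, transition probabilities $P=(p^j_{ik})$ (block matrix of type $a$, nonnegative with row sums 1) and discount factor $\gamma\in[0,1)$ is identified with a Grid-LP in stochastic form $\max r^Ty$ s.t. $Q^Ty=g$, $y\ge\mathbf 0$, where $Q$ is the stochastic K-matrix of type $a$ whose row $(j,i)$ is $e_j^T-\gamma p^j_{i\cdot}$ and $g\in\mathbb R^n$ is such that $(Q_B)^{ -T}g>\mathbf 0$ for every maximal complementary $B\subseteq N(a)$. The USO of $G(a)$ arising from it is given, for adjacent $B$ and $C=(B\setminus\{(j,i)\})\cup\{(j,k)\}$, by $B\to C$ iff $(-r_N^T+r_B^T(Q_B)^{ -T}(Q_N)^T)^j_k<0$, $N=N(a)\setminus B$. -}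

module Defs where

open import Level using (Level; _⊔_; suc)
open import Algebra.Bundles using (CommutativeRing)
open import Data.Bool.Base using (if_then_else_)
open import Data.Fin.Base using (Fin; fromℕ)
open import Data.Fin.Properties using (_≟_)
open import Data.Fin.Subset using (Subset; _∈_)
open import Data.Nat.Base as ℕ using (ℕ)
open import Data.Product.Base using (∃; ∃-syntax; _×_)
open import Data.Sum.Base using (_⊎_)
open import Data.Vec.Functional using (Vector; insertAt; transpose)
open import Function.Bundles using (_⇔_)
open import Relation.Binary.Core using (Rel)
open import Relation.Binary.PropositionalEquality.Core using (_≡_; _≢_)
open import Relation.Binary.Structures using (IsStrictTotalOrder)
open import Relation.Nullary.Decidable.Core using (⌊_⌋)
open import Relation.Nullary.Negation.Core using (¬_)
import Algebra.Properties.Semiring.Sum as Sum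
import Relation.Binary.Construct.StrictToNonStrict as NonStrict

BlockType : ℕ → Set
BlockType n = Vector ℕ n

PositiveType : ∀ {n} → BlockType n → Set
PositiveType b = ∀ j → 0 ℕ.< b j

_+𝟏 : ∀ {n} → BlockType n → BlockType n
(b +𝟏) j = ℕ.suc (b j)

-- A family (v (j , i)) indexed by N(b) = {(j , i) : j ∈ [n], i ∈ [bⱼ]}, in
-- curried form.
Block : ∀ {ℓ n} → Set ℓ → BlockType n → Set ℓ
Block A b = ∀ j → Vector A (b j)

-- [ v | w ] appends wⱼ as the last entry of block j.
[_∣_] : ∀ {ℓ n} {A : Set ℓ} {b : BlockType n} → Block A b → Vector A n → Block A (b +𝟏)
[_∣_] {b = b} v w j = insertAt (v j) (fromℕ (b j)) (w j)

-- A maximal complementary subset of N(b) contains exactly one (j , i) for each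
-- j; it is given by the function sending j to that i.  Two such functions
-- represent the same set iff they agree pointwise.
Vertex : ∀ {n} → BlockType n → Set
Vertex b = ∀ j → Fin (b j)

infix 4 _≐_

_≐_ : ∀ {n} {b : BlockType n} → Rel (Vertex b) _
B ≐ C = ∀ j → B j ≡ C j

-- C = (B ∖ {(j , B j)}) ∪ {(j , C j)} with B j ≢ C j.
DifferExactlyAt : ∀ {n} {b : BlockType n} → Fin n → Rel (Vertex b) _
DifferExactlyAt j B C = B j ≢ C j × (∀ l → l ≢ j → B l ≡ C l)

Adjacent : ∀ {n} {b : BlockType n} → Rel (Vertex b) _
Adjacent B C = ∃[ j ] DifferExactlyAt j B C

infix 4 _≋_

_≋_ : ∀ {o o′ n} {a : BlockType n} → Rel (Vertex a) o → Rel (Vertex a) o′ → Set (o ⊔ o′)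
R ≋ R′ = ∀ B C → R B C ⇔ R′ B C

record IsOrientation {o n} {b : BlockType n} (_⟶_ : Rel (Vertex b) o) : Set o where
  field
    resp-≐     : ∀ {B B′ C C′} → B ≐ B′ → C ≐ C′ → B ⟶ C → B′ ⟶ C′
    edge       : ∀ {B C} → B ⟶ C → Adjacent B C
    oriented   : ∀ {B C} → Adjacent B C → B ⟶ C ⊎ C ⟶ B
    asymmetric : ∀ {B C} → B ⟶ C → ¬ (C ⟶ B)

-- A subset of N(b), given blockwise.
SubgridSet : ∀ {n} → BlockType n → Set
SubgridSet b = ∀ j → Subset (b j)

_⊆ᵥ_ : ∀ {n} {b : BlockType n} → Vertex b → SubgridSet b → Set
B ⊆ᵥ S = ∀ j → B j ∈ S j

IsSinkOf : ∀ {o n} {b : BlockType n} → Rel (Vertex b) o → SubgridSet b → Vertex b → Set o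
IsSinkOf _⟶_ S B = B ⊆ᵥ S × (∀ C → C ⊆ᵥ S → Adjacent B C → ¬ (B ⟶ C))

record IsUSO {o n} {b : BlockType n} (_⟶_ : Rel (Vertex b) o) : Set o where
  field
    isOrientation : IsOrientation _⟶_
    uniqueSink    : ∀ S → (∃[ B ] B ⊆ᵥ S) →
                    ∃[ B ] (IsSinkOf _⟶_ S B × (∀ C → IsSinkOf _⟶_ S C → C ≐ B))

-- A totally ordered field, standing for the real numbers; no completeness is
-- required.  The value of 0# ⁻¹ is unspecified.
record OrderedField c ℓ₁ ℓ₂ : Set (suc (c ⊔ ℓ₁ ⊔ ℓ₂)) where
  infix 8 _⁻¹
  infix 4 _<_
  field
    commutativeRing : CommutativeRing c ℓ₁

  open CommutativeRing commutativeRing public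

  field
    _<_                : Rel Carrier ℓ₂
    _⁻¹                : Carrier → Carrier
    isStrictTotalOrder : IsStrictTotalOrder _≈_ _<_
    0≉1                : ¬ (0# ≈ 1#)
    ⁻¹-cong            : ∀ {x y} → x ≈ y → x ⁻¹ ≈ y ⁻¹
    ⁻¹-inverse         : ∀ x → ¬ (x ≈ 0#) → x * x ⁻¹ ≈ 1#
    +-monoˡ-<          : ∀ {x y} z → x < y → x + z < y + z
    *-pos              : ∀ {x y} → 0# < x → 0# < y → 0# < x * y

  open NonStrict _≈_ _<_ public using (_≤_)
  open Sum semiring public using (sum)

module LP {c ℓ₁ ℓ₂} (F : OrderedField c ℓ₁ ℓ₂) where

  open OrderedField F

  Vec : ℕ → Set c
  Vec n = Vector Carrier n

  Matrix : ℕ → ℕ → Set c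
  Matrix m n = Vector (Vec n) m

  BlockVector : ∀ {n} → BlockType n → Set c
  BlockVector b = Block Carrier b

  BlockMatrix : ∀ {n} → BlockType n → Set c
  BlockMatrix {n} b = Block (Vec n) b

  infix 4 _≈ᴹ_ _≈ᴮⱽ_ _≈ᴮᴹ_

  _≈ᴹ_ : ∀ {m n} → Rel (Matrix m n) ℓ₁
  A ≈ᴹ B = ∀ i k → A i k ≈ B i k

  _≈ᴮⱽ_ : ∀ {n} {b : BlockType n} → Rel (BlockVector b) ℓ₁
  v ≈ᴮⱽ w = ∀ j i → v j i ≈ w j i

  _≈ᴮᴹ_ : ∀ {n} {b : BlockType n} → Rel (BlockMatrix b) ℓ₁
  M ≈ᴮᴹ N = ∀ j i k → M j i k ≈ N j i k

  𝟘 : ∀ {n} → Vec n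
  𝟘 _ = 0#

  I : ∀ {n} → Matrix n n
  I i k = if ⌊ i ≟ k ⌋ then 1# else 0#

  infixl 7 _∙_ _⊗_ _⊛_ _⊗ᴮ_

  _∙_ : ∀ {n} → Vec n → Vec n → Carrier
  v ∙ w = sum (λ i → v i * w i)

  _⊗_ : ∀ {m n k} → Matrix m n → Matrix n k → Matrix m k
  (A ⊗ B) i k = A i ∙ (λ l → B l k)

  _⊛_ : ∀ {m n} → Matrix m n → Vec n → Vec m
  (A ⊛ v) i = A i ∙ v

  _⊗ᴮ_ : ∀ {n} {b : BlockType n} → BlockMatrix b → Matrix n n → BlockMatrix b
  (M ⊗ᴮ X) j = M j ⊗ X

  -- The representative submatrix (or subvector) of rows in B.
  infixl 9 _⟦_⟧

  _⟦_⟧ : ∀ {ℓ n} {A : Set ℓ} {b : BlockType n} → Block A b → Vertex b → Vector A n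
  (M ⟦ B ⟧) j = M j (B j)

  IsInverse : ∀ {n} → Matrix n n → Matrix n n → Set ℓ₁
  IsInverse A A′ = (A ⊗ A′ ≈ᴹ I) × (A′ ⊗ A ≈ᴹ I)

  IsZ : ∀ {n} → Matrix n n → Set (ℓ₁ ⊔ ℓ₂)
  IsZ X = ∀ i k → i ≢ k → X i k ≤ 0#

  IsBlockZ : ∀ {n} {b : BlockType n} → BlockMatrix b → Set (ℓ₁ ⊔ ℓ₂)
  IsBlockZ Y = ∀ B → IsZ (Y ⟦ B ⟧)

  IsProperHiddenKWitness : ∀ {n} {b : BlockType n} →
                           BlockMatrix b → Matrix n n → BlockMatrix b → Set (ℓ₁ ⊔ ℓ₂)
  IsProperHiddenKWitness M X Y =
    IsZ X × IsBlockZ Y × (M ⊗ᴮ X ≈ᴮᴹ Y) × (∀ j i → 0# < sum ([ Y ∣ X ] j i))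

  IsStochastic : ∀ {n} → Matrix n n → Set (ℓ₁ ⊔ ℓ₂)
  IsStochastic S = (∀ i k → 0# ≤ S i k) × (∀ i → sum (S i) ≈ 1#)

  IsStochasticK : ∀ {n} {b : BlockType n} → BlockMatrix b → Set (c ⊔ ℓ₁ ⊔ ℓ₂)
  IsStochasticK Q =
    ∃[ γ ] (0# ≤ γ × γ < 1# ×
            (∀ B → ∃[ S ] (IsStochastic S × (Q ⟦ B ⟧ ≈ᴹ λ i k → I i k - γ * S i k))))

  -- Products with diagonal matrices, which are given by their diagonals:
  -- L of order m = Σⱼ bⱼ by a block vector, H of order n by a vector.
  _⊗ᴰᴮ_ : ∀ {n} {b : BlockType n} → BlockVector b → BlockMatrix b → BlockMatrix b
  (L ⊗ᴰᴮ Y) j i k = L j i * Y j i k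

  _⁻¹⊗ᴰ_ : ∀ {n} → Vec n → Matrix n n → Matrix n n
  (H ⁻¹⊗ᴰ X) j k = H j ⁻¹ * X j k

  -- For the matrix A whose columns are the rows of W (that is, A = Wᵀ): every
  -- A_B is nonsingular and A_B⁻¹ p > 0.  The j-th column of A_B is the one
  -- belonging to block j, and the rows of A_B⁻¹ are indexed accordingly.
  record FeasibleBases {n} {a : BlockType n} (W : BlockMatrix a) (p : Vec n) :
         Set (c ⊔ ℓ₁ ⊔ ℓ₂) where
    field
      inv      : Vertex a → Matrix n n
      inverse  : ∀ B → IsInverse (transpose (W ⟦ B ⟧)) (inv B)
      positive : ∀ B j → 0# < (inv B ⊛ p) j

  -- min qᵀu  subject to  Mᵀu ≤ p, u ≥ 0;  here A = [Mᵀ | I].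
  record GridLP {n} (b : BlockType n) : Set (c ⊔ ℓ₁ ⊔ ℓ₂) where
    field
      M     : BlockMatrix b
      q     : BlockVector b
      p     : Vec n
      bases : FeasibleBases [ M ∣ I ] p

    open FeasibleBases bases public

    cost : BlockVector (b +𝟏)
    cost = [ q ∣ 𝟘 ]

    -- The entry of c_Nᵀ − c_Bᵀ A_B⁻¹ A_N at (j , k).
    reducedCost : Vertex (b +𝟏) → BlockVector (b +𝟏)
    reducedCost B j k = cost j k - cost ⟦ B ⟧ ∙ (inv B ⊛ [ M ∣ I ] j k)

    DualNondegenerate : Set ℓ₁
    DualNondegenerate = ∀ B j k → k ≢ B j → ¬ (reducedCost B j k ≈ 0#)

    _⟶_ : Rel (Vertex (b +𝟏)) ℓ₂
    B ⟶ C = ∃[ j ] (DifferExactlyAt j B C × reducedCost B j (C j) < 0#)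

  -- max rᵀy  subject to  Qᵀy = g, y ≥ 0.
  record DiscountedMDP {n} (a : BlockType n) : Set (c ⊔ ℓ₁ ⊔ ℓ₂) where
    field
      actions  : PositiveType a
      r        : BlockVector a
      P        : BlockMatrix a
      P-nonneg : ∀ j i k → 0# ≤ P j i k
      P-sum    : ∀ j i → sum (P j i) ≈ 1#
      γ        : Carrier
      0≤γ      : 0# ≤ γ
      γ<1      : γ < 1#

    Q : BlockMatrix a
    Q j i k = I j k - γ * P j i k

    field
      g     : Vec n
      bases : FeasibleBases Q g

    open FeasibleBases bases public

    -- The entry of −r_Nᵀ + r_Bᵀ (Q_B)⁻ᵀ (Q_N)ᵀ at (j , k).
    reducedCost : Vertex a → BlockVector a
    reducedCost B j k = - r j k + r ⟦ B ⟧ ∙ (inv B ⊛ Q j k)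

    _⟶_ : Rel (Vertex a) ℓ₂
    B ⟶ C = ∃[ j ] (DifferExactlyAt j B C × reducedCost B j (C j) < 0#)

  IsLPUSO : ∀ {o n} {b : BlockType n} → Rel (Vertex (b +𝟏)) o → Set (c ⊔ ℓ₁ ⊔ ℓ₂ ⊔ o)
  IsLPUSO {b = b} U =
    IsUSO U × (∃ λ (G : GridLP b) → GridLP.DualNondegenerate G × U ≋ GridLP._⟶_ G)

  Positiveⱽ : ∀ {n} → Vec n → Set ℓ₂
  Positiveⱽ v = ∀ j → 0# < v j

  Positiveᴮ : ∀ {n} {b : BlockType n} → BlockVector b → Set ℓ₂
  Positiveᴮ v = ∀ j i → 0# < v j i

  -- [LY | H⁻¹X].
  scaledMatrix : ∀ {n} {b : BlockType n} →
                 BlockVector b → BlockMatrix b → Vec n → Matrix n n → BlockMatrix (b +𝟏)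
  scaledMatrix L Y H X = [ L ⊗ᴰᴮ Y ∣ H ⁻¹⊗ᴰ X ]

  -- D is the discounted MDP
  --   max −[qᵀL | 0] y  subject to  [YᵀL | XᵀH⁻¹] y = Xᵀp, y ≥ 0.
  IsScaledMDPOf : ∀ {n} {b : BlockType n} → GridLP b →
                  Matrix n n → BlockMatrix b → BlockVector b → Vec n →
                  DiscountedMDP (b +𝟏) → Set ℓ₁
  IsScaledMDPOf G X Y L H D =
    (r ≈ᴮⱽ λ j i → - [ (λ l k → q l k * L l k) ∣ 𝟘 ] j i) ×
    (Q ≈ᴮᴹ scaledMatrix L Y H X) ×
    (∀ k → g k ≈ (transpose X ⊛ p) k)
    where
    open GridLP G using (q; p)
    open DiscountedMDP D using (r; Q; g)

{-# OPTIONS --safe #-}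

-- With W = [ M ∣ I ], the rows of the scaled MDP are Q = δ W X for a positive row
-- scaling δ, so its basic solutions are those of the Grid-LP divided by δ_B, and
-- its reduced costs are those of the Grid-LP multiplied by δ: all signs agree.
--
-- For a hidden K-witness, note that for every cost vector a vertex B of least
-- value c_Bᵀ A_B⁻¹ p is dual optimal: there is π with W π ≤ c and pᵀ π = c_Bᵀ A_B⁻¹ p.
-- The indicator of block k as c gives xₖ with W xₖ ≤ 0 outside block k and
-- pᵀ xₖ > 0, and c = −1 gives z = −π with W z > 0.  The matrix X₀ with columns xₖ
-- is a Z-matrix with p > 0 and pᵀ X₀ > 0, hence a K-matrix, so X₀ α = z has a
-- solution α > 0.  Then X = X₀ diag(α) and Y = M X form a witness, since the
-- row sums of W X are the entries of W z.

module Submission where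

open import Data.Fin.Base using (Fin; zero; suc; fromℕ; fromℕ<; punchIn)
open import Data.Fin.Properties using (_≟_; ∀-cons; punchInᵢ≢i)
open import Data.Nat.Base as ℕ using (ℕ)
open import Data.Product.Base using (∃; ∃-syntax; _×_; _,_; proj₁; proj₂; map₂)
open import Data.Sum.Base using (inj₁; inj₂)
open import Data.Vec.Functional using (Vector; insertAt; transpose)
open import Data.Vec.Functional.Properties using (insertAt-lookup; insertAt-punchIn)
open import Function.Base using (_∘_)
open import Function.Bundles using (mk⇔)
open import Function.Construct.Composition using (_⇔-∘_)
open import Level using (_⊔_)
open import Relation.Binary.Bundles using (StrictPartialOrder)
open import Relation.Binary.Core using (Rel)
open import Relation.Binary.Definitions using (tri<; tri≈; tri>)
open import Relation.Binary.PropositionalEquality.Core as ≡ using (_≡_; _≢_)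
open import Relation.Binary.Structures using (IsStrictTotalOrder; IsTotalOrder)
open import Relation.Nullary.Decidable.Core using (Dec; yes; no)
open import Relation.Nullary.Negation.Core using (¬_; contradiction)
import Algebra.Properties.Ring as RingProperties
import Algebra.Properties.Semiring.Sum as SemiringSum
import Algebra.Solver.Ring.NaturalCoefficients.Default as NaturalCoefficients
import Relation.Binary.Construct.StrictToNonStrict as NonStrict
import Relation.Binary.Reasoning.StrictPartialOrder as StrictPartialOrderReasoning
open import Defs

-- Ordered fields: signs, finite sums, finite bounds and minima.

module OrderedFieldProperties {c ℓ₁ ℓ₂} (F : OrderedField c ℓ₁ ℓ₂) where

  open OrderedField F hiding (zero)
  open IsStrictTotalOrder isStrictTotalOrder public
    using (compare; irrefl; asym; <-respˡ-≈; <-respʳ-≈; isStrictPartialOrder)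
    renaming (trans to <-trans)
  open RingProperties ring
  open SemiringSum semiring using (sum-cong-≋; sum-remove; sum-replicate-zero)

  strictPartialOrder : StrictPartialOrder c ℓ₁ ℓ₂
  strictPartialOrder = record { isStrictPartialOrder = isStrictPartialOrder }

  open StrictPartialOrderReasoning strictPartialOrder

  open IsTotalOrder (NonStrict.isTotalOrder _≈_ _<_ isStrictTotalOrder) public
    using () renaming (refl to ≤-refl; trans to ≤-trans; total to ≤-total)

  ≮⇒≥ : ∀ {x y} → ¬ (x < y) → y ≤ x
  ≮⇒≥ {x} {y} x≮y with compare x y
  ... | tri< x<y _ _ = contradiction x<y x≮y
  ... | tri≈ _ x≈y _ = inj₂ (sym x≈y)
  ... | tri> _ _ y<x = inj₁ y<x

  <⇒≱ : ∀ {x y} → x < y → ¬ (y ≤ x)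
  <⇒≱ x<y (inj₁ y<x) = asym x<y y<x
  <⇒≱ x<y (inj₂ y≈x) = irrefl (sym y≈x) x<y

  +-monoˡ-≤ : ∀ {x y} z → x ≤ y → x + z ≤ y + z
  +-monoˡ-≤ z (inj₁ x<y) = inj₁ (+-monoˡ-< z x<y)
  +-monoˡ-≤ z (inj₂ x≈y) = inj₂ (+-congʳ x≈y)

  +-monoʳ-≤ : ∀ z {x y} → x ≤ y → z + x ≤ z + y
  +-monoʳ-≤ z {x} {y} x≤y = begin
    z + x  ≈⟨ +-comm z x ⟩
    x + z  ≤⟨ +-monoˡ-≤ z x≤y ⟩
    y + z  ≈⟨ +-comm y z ⟩
    z + y  ∎

  +-nonneg : ∀ {x y} → 0# ≤ x → 0# ≤ y → 0# ≤ x + y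
  +-nonneg {x} {y} 0≤x 0≤y = begin
    0#      ≤⟨ 0≤x ⟩
    x       ≈⟨ +-identityʳ x ⟨
    x + 0#  ≤⟨ +-monoʳ-≤ x 0≤y ⟩
    x + y   ∎

  +-nonpos : ∀ {x y} → x ≤ 0# → y ≤ 0# → x + y ≤ 0#
  +-nonpos {x} {y} x≤0 y≤0 = begin
    x + y   ≤⟨ +-monoʳ-≤ x y≤0 ⟩
    x + 0#  ≈⟨ +-identityʳ x ⟩
    x       ≤⟨ x≤0 ⟩
    0#      ∎

  +-pos-nonneg : ∀ {x y} → 0# < x → 0# ≤ y → 0# < x + y
  +-pos-nonneg {x} {y} 0<x 0≤y = begin-strict
    0#      <⟨ 0<x ⟩
    x       ≈⟨ +-identityʳ x ⟨
    x + 0#  ≤⟨ +-monoʳ-≤ x 0≤y ⟩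
    x + y   ∎

  +-pos-cancelʳ : ∀ {x y} → 0# < x + y → y ≤ 0# → 0# < x
  +-pos-cancelʳ {x} {y} 0<x+y y≤0 = begin-strict
    0#      <⟨ 0<x+y ⟩
    x + y   ≤⟨ +-monoʳ-≤ x y≤0 ⟩
    x + 0#  ≈⟨ +-identityʳ x ⟩
    x       ∎

  x≤y⇒0≤y-x : ∀ {x y} → x ≤ y → 0# ≤ y - x
  x≤y⇒0≤y-x {x} {y} x≤y = begin
    0#     ≈⟨ -‿inverseʳ x ⟨
    x - x  ≤⟨ +-monoˡ-≤ (- x) x≤y ⟩
    y - x  ∎

  x<y⇒0<y-x : ∀ {x y} → x < y → 0# < y - x
  x<y⇒0<y-x {x} {y} x<y = begin-strict
    0#     ≈⟨ -‿inverseʳ x ⟨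
    x - x  <⟨ +-monoˡ-< (- x) x<y ⟩
    y - x  ∎

  -‿nonpos : ∀ {x} → x ≤ 0# → 0# ≤ - x
  -‿nonpos {x} x≤0 = begin
    0#      ≤⟨ x≤y⇒0≤y-x x≤0 ⟩
    0# - x  ≈⟨ +-identityˡ (- x) ⟩
    - x     ∎

  -‿neg : ∀ {x} → x < 0# → 0# < - x
  -‿neg {x} x<0 = begin-strict
    0#      <⟨ x<y⇒0<y-x x<0 ⟩
    0# - x  ≈⟨ +-identityˡ (- x) ⟩
    - x     ∎

  -‿nonneg : ∀ {x} → 0# ≤ x → - x ≤ 0#
  -‿nonneg {x} 0≤x = begin
    - x       ≈⟨ +-identityˡ (- x) ⟨
    0# - x    ≤⟨ +-monoˡ-≤ (- x) 0≤x ⟩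
    x - x     ≈⟨ -‿inverseʳ x ⟩
    0#        ∎

  -‿nonneg⁻¹ : ∀ {x} → 0# ≤ - x → x ≤ 0#
  -‿nonneg⁻¹ {x} 0≤-x = begin
    x        ≈⟨ -‿involutive x ⟨
    - (- x)  ≤⟨ -‿nonneg 0≤-x ⟩
    0#       ∎

  *-nonneg : ∀ {x y} → 0# ≤ x → 0# ≤ y → 0# ≤ x * y
  *-nonneg         (inj₁ 0<x) (inj₁ 0<y) = inj₁ (*-pos 0<x 0<y)
  *-nonneg {x}     (inj₁ _)   (inj₂ 0≈y) = inj₂ (trans (sym (zeroʳ x)) (*-congˡ 0≈y))
  *-nonneg {_} {y} (inj₂ 0≈x) _          = inj₂ (trans (sym (zeroˡ y)) (*-congʳ 0≈x))

  *-nonneg-nonpos : ∀ {x y} → 0# ≤ x → y ≤ 0# → x * y ≤ 0#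
  *-nonneg-nonpos {x} {y} 0≤x y≤0 = -‿nonneg⁻¹ (begin
    0#         ≤⟨ *-nonneg 0≤x (-‿nonpos y≤0) ⟩
    x * - y    ≈⟨ -‿distribʳ-* x y ⟨
    - (x * y)  ∎)

  *-nonpos-nonneg : ∀ {x y} → x ≤ 0# → 0# ≤ y → x * y ≤ 0#
  *-nonpos-nonneg {x} {y} x≤0 0≤y = begin
    x * y  ≈⟨ *-comm x y ⟩
    y * x  ≤⟨ *-nonneg-nonpos 0≤y x≤0 ⟩
    0#     ∎

  *-nonpos : ∀ {x y} → x ≤ 0# → y ≤ 0# → 0# ≤ x * y
  *-nonpos {x} {y} x≤0 y≤0 = begin
    0#           ≤⟨ -‿nonpos (*-nonneg-nonpos (-‿nonpos x≤0) y≤0) ⟩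
    - (- x * y)  ≈⟨ -‿cong (-‿distribˡ-* x y) ⟨
    - - (x * y)  ≈⟨ -‿involutive (x * y) ⟩
    x * y        ∎

  *-monoˡ-≤-nonneg : ∀ {x y z} → 0# ≤ z → x ≤ y → z * x ≤ z * y
  *-monoˡ-≤-nonneg {x} {y} {z} 0≤z x≤y = begin
    z * x                  ≈⟨ +-identityˡ (z * x) ⟨
    0# + z * x             ≤⟨ +-monoˡ-≤ (z * x) (*-nonneg 0≤z (x≤y⇒0≤y-x x≤y)) ⟩
    z * (y - x) + z * x    ≈⟨ distribˡ z (y - x) x ⟨
    z * (y - x + x)        ≈⟨ *-congˡ (//-rightDividesˡ x y) ⟩
    z * y                  ∎

  *-pos-cancelˡ : ∀ {x y} → 0# < x → 0# < x * y → 0# < y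
  *-pos-cancelˡ {x} {y} 0<x 0<xy with compare 0# y
  ... | tri< 0<y _ _ = 0<y
  ... | tri≈ _ 0≈y _ = contradiction (*-nonneg-nonpos (inj₁ 0<x) (inj₂ (sym 0≈y))) (<⇒≱ 0<xy)
  ... | tri> _ _ y<0 = contradiction (*-nonneg-nonpos (inj₁ 0<x) (inj₁ y<0)) (<⇒≱ 0<xy)

  *-pos-neg : ∀ {x y} → 0# < x → y < 0# → x * y < 0#
  *-pos-neg {x} {y} 0<x y<0 = begin-strict
    x * y                 ≈⟨ +-identityʳ (x * y) ⟨
    x * y + 0#            <⟨ +-monoʳ-< (x * y) (*-pos 0<x (-‿neg y<0)) ⟩
    x * y + x * - y       ≈⟨ distribˡ x y (- y) ⟨
    x * (y - y)           ≈⟨ *-congˡ (-‿inverseʳ y) ⟩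
    x * 0#                ≈⟨ zeroʳ x ⟩
    0#                    ∎
    where
    +-monoʳ-< : ∀ z {x y} → x < y → z + x < z + y
    +-monoʳ-< z {x} {y} x<y = begin-strict
      z + x  ≈⟨ +-comm z x ⟩
      x + z  <⟨ +-monoˡ-< z x<y ⟩
      y + z  ≈⟨ +-comm y z ⟩
      z + y  ∎

  *-pos-neg-cancelˡ : ∀ {x y} → 0# < x → x * y < 0# → y < 0#
  *-pos-neg-cancelˡ {x} {y} 0<x xy<0 with compare y 0#
  ... | tri< y<0 _ _ = y<0
  ... | tri≈ _ y≈0 _ = contradiction (*-nonneg (inj₁ 0<x) (inj₂ (sym y≈0))) (<⇒≱ xy<0)
  ... | tri> _ _ 0<y = contradiction (inj₁ (*-pos 0<x 0<y)) (<⇒≱ xy<0)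

  pos⇒≉0 : ∀ {x} → 0# < x → ¬ (x ≈ 0#)
  pos⇒≉0 0<x x≈0 = irrefl (sym x≈0) 0<x

  *-⁻¹ : ∀ {x} → 0# < x → x * x ⁻¹ ≈ 1#
  *-⁻¹ {x} 0<x = ⁻¹-inverse x (pos⇒≉0 0<x)

  ⁻¹-* : ∀ {x} → 0# < x → x ⁻¹ * x ≈ 1#
  ⁻¹-* {x} 0<x = trans (*-comm (x ⁻¹) x) (*-⁻¹ 0<x)

  0<1 : 0# < 1#
  0<1 with compare 0# 1#
  ... | tri< 0<1 _ _ = 0<1
  ... | tri≈ _ 0≈1 _ = contradiction 0≈1 0≉1
  -- The goal is reached in this case too: if -1 is positive, then so is its square, which is 1.
  ... | tri> _ _ 1<0 = begin-strict
    0#            <⟨ *-pos (-‿neg 1<0) (-‿neg 1<0) ⟩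
    - 1# * - 1#   ≈⟨ -1*x≈-x (- 1#) ⟩
    - - 1#        ≈⟨ -‿involutive 1# ⟩
    1#            ∎

  ⁻¹-pos : ∀ {x} → 0# < x → 0# < x ⁻¹
  ⁻¹-pos {x} 0<x = *-pos-cancelˡ 0<x (<-respʳ-≈ (sym (*-⁻¹ 0<x)) 0<1)

  *-cancelˡ : ∀ {x y z} → 0# < x → x * y ≈ x * z → y ≈ z
  *-cancelˡ {x} {y} {z} 0<x xy≈xz = begin-equality
    y                ≈⟨ *-identityˡ y ⟨
    1# * y           ≈⟨ *-congʳ (⁻¹-* 0<x) ⟨
    x ⁻¹ * x * y     ≈⟨ *-assoc (x ⁻¹) x y ⟩
    x ⁻¹ * (x * y)   ≈⟨ *-congˡ xy≈xz ⟩
    x ⁻¹ * (x * z)   ≈⟨ *-assoc (x ⁻¹) x z ⟨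
    x ⁻¹ * x * z     ≈⟨ *-congʳ (⁻¹-* 0<x) ⟩
    1# * z           ≈⟨ *-identityˡ z ⟩
    z                ∎

  sum-nonneg : ∀ {n} {f : Vector Carrier n} → (∀ i → 0# ≤ f i) → 0# ≤ sum f
  sum-nonneg {ℕ.zero}  0≤f = ≤-refl
  sum-nonneg {ℕ.suc n} 0≤f = +-nonneg (0≤f zero) (sum-nonneg (0≤f ∘ suc))

  sum-nonpos : ∀ {n} {f : Vector Carrier n} → (∀ i → f i ≤ 0#) → sum f ≤ 0#
  sum-nonpos {ℕ.zero}  f≤0 = ≤-refl
  sum-nonpos {ℕ.suc n} f≤0 = +-nonpos (f≤0 zero) (sum-nonpos (f≤0 ∘ suc))

  sum-single : ∀ {n} i (f : Vector Carrier n) → (∀ k → k ≢ i → f k ≈ 0#) → sum f ≈ f i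
  sum-single {ℕ.suc n} i f f≈0 = begin-equality
    sum f                                   ≈⟨ sum-remove f ⟩
    f i + sum (λ k → f (punchIn i k))       ≈⟨ +-congˡ (sum-cong-≋ λ k → f≈0 _ (punchInᵢ≢i i k)) ⟩
    f i + sum {n} (λ _ → 0#)                ≈⟨ +-congˡ (sum-replicate-zero n) ⟩
    f i + 0#                                ≈⟨ +-identityʳ (f i) ⟩
    f i                                     ∎

  sum-neg : ∀ {n} (f : Vector Carrier n) → sum (λ i → - f i) ≈ - sum f
  sum-neg {ℕ.zero}  f = sym -0#≈0#
  sum-neg {ℕ.suc n} f = trans (+-congˡ (sum-neg (f ∘ suc))) (-‿+-comm (f zero) (sum (f ∘ suc)))

  -- The bound has to exceed 1 because its inverse later serves as a row sum strictly between 0 and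
  -- 1. For the empty family it defaults to 1 + 1.
  upperBound : ∀ {n} (f : Vector Carrier n) → ∃[ t ] (1# < t × (∀ i → f i ≤ t))
  upperBound {ℕ.zero}  f = 1# + 1# , 1<2 , λ ()
    where
    1<2 : 1# < 1# + 1#
    1<2 = <-respˡ-≈ (+-identityˡ 1#) (+-monoˡ-< 1# 0<1)
  upperBound {ℕ.suc n} f with upperBound (f ∘ suc)
  ... | t , 1<t , f≤t with ≤-total (f zero) t
  ...   | inj₁ f₀≤t = t , 1<t , ∀-cons f₀≤t f≤t
  ...   | inj₂ t≤f₀ = f zero , 1<f₀ , ∀-cons ≤-refl (λ i → ≤-trans (f≤t i) t≤f₀)
    where
    1<f₀ : 1# < f zero
    1<f₀ = begin-strict 1# <⟨ 1<t ⟩ t ≤⟨ t≤f₀ ⟩ f zero ∎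

  -- The argument of type `Fin n` rules out the empty family.
  minimum : ∀ {n} (f : Vector Carrier n) → Fin n → ∃[ i ] (∀ k → f i ≤ f k)
  minimum {ℕ.suc ℕ.zero}    f _ = zero , ∀-cons ≤-refl λ ()
  minimum {ℕ.suc (ℕ.suc n)} f _ with minimum (f ∘ suc) zero
  ... | i , fᵢ≤f with ≤-total (f zero) (f (suc i))
  ...   | inj₁ f₀≤fᵢ = zero , ∀-cons ≤-refl λ k → ≤-trans f₀≤fᵢ (fᵢ≤f k)
  ...   | inj₂ fᵢ≤f₀ = suc i , ∀-cons fᵢ≤f₀ fᵢ≤f

  -- Minimise block by block: find the best completion for each choice in block 0, then the best
  -- such choice. The function has to respect `≐` because a vertex agrees only pointwise with the
  -- one reassembled from its head and tail.
  vertexMinimum : ∀ {n} (a : BlockType n) (f : Vertex a → Carrier) →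
                  (∀ {B C} → B ≐ C → f B ≈ f C) → Vertex a → ∃[ B ] (∀ C → f B ≤ f C)
  vertexMinimum {ℕ.zero}  a f f-cong B = B , λ C → inj₂ (f-cong λ ())
  vertexMinimum {ℕ.suc n} a f f-cong B = Bᵢ i , λ C → begin
    f (Bᵢ i)                               ≤⟨ proj₂ first (C zero) ⟩
    f (Bᵢ (C zero))                        ≤⟨ proj₂ (rest (C zero)) (C ∘ suc) ⟩
    f (∀-cons (C zero) (C ∘ suc))          ≈⟨ f-cong (∀-cons ≡.refl λ _ → ≡.refl) ⟩
    f C                                    ∎
    where
    rest : ∀ i → ∃[ B ] (∀ C → f (∀-cons i B) ≤ f (∀-cons i C))
    rest i = vertexMinimum (a ∘ suc) (f ∘ ∀-cons i)
               (λ B≐C → f-cong (∀-cons ≡.refl B≐C)) (B ∘ suc)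

    Bᵢ : Fin (a zero) → Vertex a
    Bᵢ i = ∀-cons i (proj₁ (rest i))

    first : ∃[ i ] (∀ k → f (Bᵢ i) ≤ f (Bᵢ k))
    first = minimum (f ∘ Bᵢ) (B zero)

    i : Fin (a zero)
    i = proj₁ first

-- Matrix identities, and linear systems with a Z-matrix.

module LinearAlgebra {c ℓ₁ ℓ₂} (F : OrderedField c ℓ₁ ℓ₂) where

  open OrderedField F hiding (zero)
  open OrderedFieldProperties F
  open LP F
  open RingProperties ring
  open SemiringSum semiring
    using (sum-cong-≋; *-distribˡ-sum; *-distribʳ-sum; ∑-distrib-+; ∑-comm)
  open NaturalCoefficients commutativeSemiring using (solve; _:+_; _:*_; _:=_)
  open StrictPartialOrderReasoning strictPartialOrder

  I-diag : ∀ {n} (i : Fin n) → I i i ≈ 1#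
  I-diag i with i ≟ i
  ... | yes _  = refl
  ... | no i≢i = contradiction ≡.refl i≢i

  I-off : ∀ {n} {i k : Fin n} → i ≢ k → I i k ≈ 0#
  I-off {i = i} {k} i≢k with i ≟ k
  ... | yes i≡k = contradiction i≡k i≢k
  ... | no _    = refl

  ∙-comm : ∀ {n} (v w : Vec n) → v ∙ w ≈ w ∙ v
  ∙-comm v w = sum-cong-≋ λ i → *-comm (v i) (w i)

  ∙-congˡ : ∀ {n} (u : Vec n) {v w : Vec n} → (∀ i → v i ≈ w i) → u ∙ v ≈ u ∙ w
  ∙-congˡ u v≈w = sum-cong-≋ λ i → *-congˡ (v≈w i)

  ∙-congʳ : ∀ {n} (u : Vec n) {v w : Vec n} → (∀ i → v i ≈ w i) → v ∙ u ≈ w ∙ u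
  ∙-congʳ u v≈w = sum-cong-≋ λ i → *-congʳ (v≈w i)

  ∙-scaleʳ : ∀ {n} a (v w : Vec n) → v ∙ (λ i → a * w i) ≈ a * (v ∙ w)
  ∙-scaleʳ a v w = begin-equality
    sum (λ i → v i * (a * w i))
      ≈⟨ sum-cong-≋ (λ i → solve 3 (λ x y z → x :* (y :* z) := y :* (x :* z)) refl (v i) a (w i)) ⟩
    sum (λ i → a * (v i * w i))  ≈⟨ *-distribˡ-sum a (λ i → v i * w i) ⟨
    a * (v ∙ w)                  ∎

  ∙-negʳ : ∀ {n} (v w : Vec n) → v ∙ (λ i → - w i) ≈ - (v ∙ w)
  ∙-negʳ v w = begin-equality
    sum (λ i → v i * - w i)    ≈⟨ sum-cong-≋ (λ i → -‿distribʳ-* (v i) (w i)) ⟨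
    sum (λ i → - (v i * w i))  ≈⟨ sum-neg (λ i → v i * w i) ⟩
    - (v ∙ w)                  ∎

  I-∙ : ∀ {n} (i : Fin n) (v : Vec n) → I i ∙ v ≈ v i
  I-∙ i v = begin-equality
    I i ∙ v      ≈⟨ sum-single i _ (λ k k≢i → trans (*-congʳ (I-off (k≢i ∘ ≡.sym))) (zeroˡ (v k))) ⟩
    I i i * v i  ≈⟨ *-congʳ (I-diag i) ⟩
    1# * v i     ≈⟨ *-identityˡ (v i) ⟩
    v i          ∎

  sum-I : ∀ {n} (i : Fin n) → sum (I i) ≈ 1#
  sum-I i = trans (sum-cong-≋ λ k → sym (*-identityʳ (I i k))) (I-∙ i λ _ → 1#)

  ∙-I : ∀ {n} (i : Fin n) (v : Vec n) → v ∙ (λ l → I l i) ≈ v i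
  ∙-I i v = begin-equality
    v ∙ (λ l → I l i)  ≈⟨ sum-single i _ (λ k k≢i → trans (*-congˡ (I-off k≢i)) (zeroʳ (v k))) ⟩
    v i * I i i        ≈⟨ *-congˡ (I-diag i) ⟩
    v i * 1#           ≈⟨ *-identityʳ (v i) ⟩
    v i                ∎

  ⊛-adjoint : ∀ {m n} (A : Matrix m n) (v : Vec n) (w : Vec m) →
              (A ⊛ v) ∙ w ≈ v ∙ (transpose A ⊛ w)
  ⊛-adjoint A v w = begin-equality
    sum (λ i → sum (λ k → A i k * v k) * w i)    ≈⟨ sum-cong-≋ (λ i → *-distribʳ-sum (w i) (λ k → A i k * v k)) ⟩
    sum (λ i → sum (λ k → A i k * v k * w i))    ≈⟨ ∑-comm (λ i k → A i k * v k * w i) ⟩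
    sum (λ k → sum (λ i → A i k * v k * w i))
      ≈⟨ sum-cong-≋ (λ k → sum-cong-≋ λ i → solve 3 (λ x y z → x :* y :* z := y :* (x :* z)) refl (A i k) (v k) (w i)) ⟩
    sum (λ k → sum (λ i → v k * (A i k * w i)))  ≈⟨ sum-cong-≋ (λ k → *-distribˡ-sum (v k) (λ i → A i k * w i)) ⟨
    sum (λ k → v k * sum (λ i → A i k * w i))    ∎

  ⊛-⊗ : ∀ {m n k} (A : Matrix m n) (B : Matrix n k) (w : Vec k) i →
         (A ⊛ (B ⊛ w)) i ≈ ((A ⊗ B) ⊛ w) i
  ⊛-⊗ A B w i = begin-equality
    A i ∙ (B ⊛ w)              ≈⟨ ∙-comm (A i) (B ⊛ w) ⟩
    (B ⊛ w) ∙ A i              ≈⟨ ⊛-adjoint B w (A i) ⟩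
    w ∙ (transpose B ⊛ A i)    ≈⟨ ∙-comm w (transpose B ⊛ A i) ⟩
    (transpose B ⊛ A i) ∙ w    ≈⟨ ∙-congʳ w (λ k → ∙-comm (λ l → B l k) (A i)) ⟩
    (A ⊗ B) i ∙ w              ∎

  inverse-⊛ : ∀ {n} {A A′ : Matrix n n} → A ⊗ A′ ≈ᴹ I → ∀ w i → (A ⊛ (A′ ⊛ w)) i ≈ w i
  inverse-⊛ {A = A} {A′} AA′≈I w i = begin-equality
    (A ⊛ (A′ ⊛ w)) i     ≈⟨ ⊛-⊗ A A′ w i ⟩
    (A ⊗ A′) i ∙ w       ≈⟨ ∙-congʳ w (AA′≈I i) ⟩
    I i ∙ w              ≈⟨ I-∙ i w ⟩
    w i                  ∎

  -- Solutions are recognised by substitution into the system, so that basic solutions can be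
  -- compared without computing any inverse.
  inverse-unique : ∀ {n} {A A′ : Matrix n n} → IsInverse A A′ → ∀ {v w} →
                   (∀ i → (A ⊛ v) i ≈ w i) → ∀ i → (A′ ⊛ w) i ≈ v i
  inverse-unique {A = A} {A′} (_ , A′A≈I) {v} {w} Av≈w i = begin-equality
    (A′ ⊛ w) i           ≈⟨ ∙-congˡ (A′ i) Av≈w ⟨
    (A′ ⊛ (A ⊛ v)) i     ≈⟨ inverse-⊛ A′A≈I v i ⟩
    v i                  ∎

  -- Uniqueness is included because it yields the left inverse from the right one. Positivity is
  -- included because the same elimination proves it.
  record Solution {n} (N : Matrix n n) (d : Vec n) : Set (c ⊔ ℓ₁ ⊔ ℓ₂) where
    field
      x        : Vec n
      solves   : ∀ i → (N ⊛ x) i ≈ d i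
      unique   : ∀ y → (∀ i → (N ⊛ y) i ≈ d i) → ∀ i → y i ≈ x i
      positive : Positiveⱽ d → Positiveⱽ x

  -- Gaussian elimination with the pivots taken on the diagonal: they are
  -- positive, and the Schur complement inherits the hypotheses on N and y.
  solveZ : ∀ {n} (N : Matrix n n) → IsZ N → (y : Vec n) → Positiveⱽ y →
           Positiveⱽ (transpose N ⊛ y) → (d : Vec n) → Solution N d
  solveZ {ℕ.zero}  N N-Z y 0<y 0<Nᵀy d = record
    { x = λ () ; solves = λ () ; unique = λ _ _ () ; positive = λ _ () }
  solveZ {ℕ.suc n} N N-Z y 0<y 0<Nᵀy d = record
    { x        = x
    ; solves   = x-solves
    ; unique   = x-unique
    ; positive = x-positive
    }
    where
    a : Carrier
    a = N zero zero

    r s y′ m : Vec n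
    r k = N zero (suc k)
    s j = N (suc j) zero
    y′ = y ∘ suc
    -- The multiple of row 0 that clears entry 0 of row `suc j`. It is nonnegative, so the Schur
    -- complement remains a Z-matrix.
    m j = - (s j * a ⁻¹)

    r≤0 : ∀ k → r k ≤ 0#
    r≤0 k = N-Z zero (suc k) λ ()

    s≤0 : ∀ j → s j ≤ 0#
    s≤0 j = N-Z (suc j) zero λ ()

    -- Entry 0 of Nᵀy is `a * y zero` plus nonpositive terms and is positive, hence so is
    -- `a * y zero`.
    0<a : 0# < a
    0<a = *-pos-cancelˡ (0<y zero) (<-respʳ-≈ (*-comm a (y zero))
      (+-pos-cancelʳ (0<Nᵀy zero) (sum-nonpos λ j → *-nonpos-nonneg (s≤0 j) (inj₁ (0<y (suc j))))))

    0≤m : ∀ j → 0# ≤ m j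
    0≤m j = -‿nonpos (*-nonpos-nonneg (s≤0 j) (inj₁ (⁻¹-pos 0<a)))

    s+ma≈0 : ∀ j → s j + m j * a ≈ 0#
    s+ma≈0 j = begin-equality
      s j + m j * a                  ≈⟨ +-congˡ (-‿distribˡ-* (s j * a ⁻¹) a) ⟨
      s j - s j * a ⁻¹ * a
        ≈⟨ +-congˡ (-‿cong (trans (*-assoc (s j) (a ⁻¹) a) (trans (*-congˡ (⁻¹-* 0<a)) (*-identityʳ (s j))))) ⟩
      s j - s j                      ≈⟨ -‿inverseʳ (s j) ⟩
      0#                             ∎

    N′ : Matrix n n
    N′ j k = N (suc j) (suc k) + m j * r k

    d′ : Vec n
    d′ j = d (suc j) + m j * d zero

    -- Stated for arbitrary `v`, so that it serves both existence and uniqueness; the coefficient of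
    -- `v zero` vanishes by `s+ma≈0`.
    eliminate : ∀ v j → (N ⊛ v) (suc j) + m j * (N ⊛ v) zero ≈ (N′ ⊛ (v ∘ suc)) j
    eliminate v j = begin-equality
      (s j * v₀ + N₁v) + m j * (a * v₀ + rv)
        ≈⟨ solve 6 (λ s v n m a r → s :* v :+ n :+ m :* (a :* v :+ r) := (s :+ m :* a) :* v :+ (n :+ m :* r)) refl (s j) v₀ N₁v (m j) a rv ⟩
      (s j + m j * a) * v₀ + (N₁v + m j * rv)      ≈⟨ +-congʳ (trans (*-congʳ (s+ma≈0 j)) (zeroˡ v₀)) ⟩
      0# + (N₁v + m j * rv)                        ≈⟨ +-identityˡ (N₁v + m j * rv) ⟩
      N₁v + m j * rv                               ≈⟨ +-congˡ (*-distribˡ-sum (m j) (λ k → r k * v (suc k))) ⟩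
      N₁v + sum (λ k → m j * (r k * v (suc k)))
        ≈⟨ ∑-distrib-+ (λ k → N (suc j) (suc k) * v (suc k)) (λ k → m j * (r k * v (suc k))) ⟨
      sum (λ k → N (suc j) (suc k) * v (suc k) + m j * (r k * v (suc k)))
        ≈⟨ sum-cong-≋ (λ k → solve 4 (λ n v m r → n :* v :+ m :* (r :* v) := (n :+ m :* r) :* v) refl (N (suc j) (suc k)) (v (suc k)) (m j) (r k)) ⟩
      (N′ ⊛ (v ∘ suc)) j                           ∎
      where
      v₀ N₁v rv : Carrier
      v₀  = v zero
      N₁v = sum (λ k → N (suc j) (suc k) * v (suc k))
      rv  = sum (λ k → r k * v (suc k))

    N′-Z : IsZ N′
    N′-Z j k j≢k = +-nonpos (N-Z (suc j) (suc k) λ { ≡.refl → j≢k ≡.refl }) (*-nonneg-nonpos (0≤m j) (r≤0 k))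

    μ : Carrier
    μ = m ∙ y′

    -- By the choice of `m`, `a * μ` equals `- (s ∙ y′)`; thus `a * (y zero - μ)` is entry 0 of Nᵀy.
    μ<y₀ : 0# < y zero - μ
    μ<y₀ = *-pos-cancelˡ 0<a (begin-strict
      0#                                 <⟨ 0<Nᵀy zero ⟩
      a * y zero + s ∙ y′                ≈⟨ +-congˡ (+-inverseˡ-unique (s ∙ y′) (a * μ) sy′+aμ≈0) ⟩
      a * y zero - a * μ                 ≈⟨ x[y-z]≈xy-xz a (y zero) μ ⟨
      a * (y zero - μ)                   ∎)
      where
      sy′+aμ≈0 : s ∙ y′ + a * μ ≈ 0#
      sy′+aμ≈0 = begin-equality
        s ∙ y′ + a * μ                               ≈⟨ +-congˡ (*-distribˡ-sum a (λ j → m j * y′ j)) ⟩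
        s ∙ y′ + sum (λ j → a * (m j * y′ j))        ≈⟨ ∑-distrib-+ (λ j → s j * y′ j) (λ j → a * (m j * y′ j)) ⟨
        sum (λ j → s j * y′ j + a * (m j * y′ j))
          ≈⟨ sum-cong-≋ (λ j → solve 4 (λ s y a m → s :* y :+ a :* (m :* y) := y :* (s :+ m :* a)) refl (s j) (y′ j) a (m j)) ⟩
        sum (λ j → y′ j * (s j + m j * a))           ≈⟨ ∙-congˡ y′ s+ma≈0 ⟩
        y′ ∙ 𝟘                                       ≈⟨ *-distribʳ-sum 0# y′ ⟨
        sum y′ * 0#                                  ≈⟨ zeroʳ (sum y′) ⟩
        0#                                           ∎

    -- Entry `k` is entry `suc k` of Nᵀy minus `r k * (y zero - μ)`, and the subtracted product is
    -- nonpositive.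
    0<N′ᵀy′ : Positiveⱽ (transpose N′ ⊛ y′)
    0<N′ᵀy′ k = begin-strict
      0#
        <⟨ +-pos-nonneg (0<Nᵀy (suc k)) (*-nonpos (r≤0 k) (-‿nonneg (inj₁ μ<y₀))) ⟩
      (r k * y zero + N₁y) + r k * - (y zero - μ)
        ≈⟨ solve 4 (λ r y n t → r :* y :+ n :+ r :* t := n :+ r :* (y :+ t)) refl (r k) (y zero) N₁y (- (y zero - μ)) ⟩
      N₁y + r k * (y zero - (y zero - μ))
        ≈⟨ +-congˡ (*-congˡ (trans (+-congˡ (⁻¹-anti-homo‿- (y zero) μ)) (trans (+-comm (y zero) (μ - y zero)) (//-rightDividesˡ (y zero) μ)))) ⟩
      N₁y + r k * μ                              ≈⟨ +-congˡ (*-distribˡ-sum (r k) (λ j → m j * y′ j)) ⟩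
      N₁y + sum (λ j → r k * (m j * y′ j))
        ≈⟨ ∑-distrib-+ (λ j → N (suc j) (suc k) * y′ j) (λ j → r k * (m j * y′ j)) ⟨
      sum (λ j → N (suc j) (suc k) * y′ j + r k * (m j * y′ j))
        ≈⟨ sum-cong-≋ (λ j → solve 4 (λ n y r m → n :* y :+ r :* (m :* y) := (n :+ m :* r) :* y) refl (N (suc j) (suc k)) (y′ j) (r k) (m j)) ⟩
      (transpose N′ ⊛ y′) k                      ∎
      where
      N₁y : Carrier
      N₁y = sum (λ j → N (suc j) (suc k) * y′ j)

    module S = Solution (solveZ N′ N′-Z y′ (0<y ∘ suc) 0<N′ᵀy′ d′)

    x : Vec (ℕ.suc n)
    -- Back substitution in row 0.
    x = ∀-cons (a ⁻¹ * (d zero - r ∙ S.x)) S.x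

    x-solves₀ : (N ⊛ x) zero ≈ d zero
    x-solves₀ = begin-equality
      a * (a ⁻¹ * (d zero - r ∙ S.x)) + r ∙ S.x  ≈⟨ +-congʳ (*-assoc a (a ⁻¹) (d zero - r ∙ S.x)) ⟨
      a * a ⁻¹ * (d zero - r ∙ S.x) + r ∙ S.x
        ≈⟨ +-congʳ (trans (*-congʳ (*-⁻¹ 0<a)) (*-identityˡ (d zero - r ∙ S.x))) ⟩
      d zero - r ∙ S.x + r ∙ S.x                 ≈⟨ //-rightDividesˡ (r ∙ S.x) (d zero) ⟩
      d zero                                     ∎

    x-solves : ∀ i → (N ⊛ x) i ≈ d i
    x-solves zero    = x-solves₀
    x-solves (suc j) = +-cancelʳ (m j * d zero) ((N ⊛ x) (suc j)) (d (suc j)) (begin-equality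
      (N ⊛ x) (suc j) + m j * d zero            ≈⟨ +-congˡ (*-congˡ x-solves₀) ⟨
      (N ⊛ x) (suc j) + m j * (N ⊛ x) zero      ≈⟨ eliminate x j ⟩
      (N′ ⊛ S.x) j                              ≈⟨ S.solves j ⟩
      d′ j                                      ∎)

    x-unique : ∀ v → (∀ i → (N ⊛ v) i ≈ d i) → ∀ i → v i ≈ x i
    x-unique v Nv≈d = ∀-cons v₀≈x₀ v′≈x′
      where
      v′≈x′ : ∀ k → v (suc k) ≈ S.x k
      v′≈x′ = S.unique (v ∘ suc) λ j →
        trans (sym (eliminate v j)) (+-cong (Nv≈d (suc j)) (*-congˡ (Nv≈d zero)))

      v₀≈x₀ : v zero ≈ x zero
      v₀≈x₀ = *-cancelˡ 0<a (+-cancelʳ (r ∙ S.x) (a * v zero) (a * x zero) (begin-equality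
        a * v zero + r ∙ S.x          ≈⟨ +-congˡ (∙-congˡ r v′≈x′) ⟨
        (N ⊛ v) zero                  ≈⟨ Nv≈d zero ⟩
        d zero                        ≈⟨ x-solves₀ ⟨
        a * x zero + r ∙ S.x          ∎))

    -- Nonnegative multipliers keep `d′` positive, and back substitution subtracts only nonpositive
    -- terms from `d zero`.
    x-positive : Positiveⱽ d → Positiveⱽ x
    x-positive 0<d = ∀-cons 0<x₀ 0<x′
      where
      0<x′ : Positiveⱽ S.x
      0<x′ = S.positive λ j → +-pos-nonneg (0<d (suc j)) (*-nonneg (0≤m j) (inj₁ (0<d zero)))

      0<x₀ : 0# < a ⁻¹ * (d zero - r ∙ S.x)
      0<x₀ = *-pos (⁻¹-pos 0<a) (+-pos-nonneg (0<d zero)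
        (-‿nonpos (sum-nonpos λ k → *-nonpos-nonneg (r≤0 k) (inj₁ (0<x′ k)))))

  -- The solutions for the unit vectors are the columns of a right inverse. It is also a left
  -- inverse: column `k` of N′N and the unit vector at `k` are both sent by N to column `k` of N,
  -- and solutions are unique.
  solvable⇒invertible : ∀ {n} {N : Matrix n n} → (∀ d → Solution N d) → ∃[ N′ ] IsInverse N N′
  solvable⇒invertible {n} {N} S = N′ , NN′≈I , N′N≈I
    where
    N′ : Matrix n n
    N′ i k = Solution.x (S (λ l → I l k)) i

    NN′≈I : N ⊗ N′ ≈ᴹ I
    NN′≈I i k = Solution.solves (S (λ l → I l k)) i

    N′N≈I : N′ ⊗ N ≈ᴹ I
    N′N≈I i k = begin-equality
      (N′ ⊗ N) i k                ≈⟨ Solution.unique (S Nₖ) (N′ ⊛ Nₖ) (inverse-⊛ NN′≈I Nₖ) i ⟩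
      Solution.x (S Nₖ) i         ≈⟨ Solution.unique (S Nₖ) (λ l → I l k) (λ j → ∙-I k (N j)) i ⟨
      I i k                       ∎
      where
      Nₖ : Vec n
      Nₖ l = N l k

-- Changing a vertex in one block, and reasoning about appended entries.

_[_≔_] : ∀ {n} {a : BlockType n} → Vertex a → ∀ j → Fin (a j) → Vertex a
(B [ j ≔ k ]) l with l ≟ j
... | yes ≡.refl = k
... | no _       = B l

≔-lookup : ∀ {n} {a : BlockType n} (B : Vertex a) j k → (B [ j ≔ k ]) j ≡ k
≔-lookup B j k with j ≟ j
... | yes ≡.refl = ≡.refl
... | no j≢j     = contradiction ≡.refl j≢j

≔-minimal : ∀ {n} {a : BlockType n} (B : Vertex a) {j} {k} {l} → l ≢ j → (B [ j ≔ k ]) l ≡ B l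
≔-minimal B {j} {l = l} l≢j with l ≟ j
... | yes l≡j = contradiction l≡j l≢j
... | no _    = ≡.refl

-- A relation between appended vectors is checked on the old entries and on the new one. Three
-- vectors suit relations of the form x ≈ d * e; simpler relations repeat a vector.
append-zip : ∀ {p q r s m} {A : Set p} {B : Set q} {C : Set r} (R : A → B → C → Set s)
             {u : Vector A m} {v : Vector B m} {w : Vector C m} {x y z} →
             (∀ i → R (u i) (v i) (w i)) → R x y z →
             ∀ i → R (insertAt u (fromℕ m) x i) (insertAt v (fromℕ m) y i) (insertAt w (fromℕ m) z i)
append-zip {m = ℕ.zero}  R Ruvw Rxyz zero    = Rxyz
append-zip {m = ℕ.suc m} R Ruvw Rxyz zero    = Ruvw zero
append-zip {m = ℕ.suc m} R Ruvw Rxyz (suc i) = append-zip R (Ruvw ∘ suc) Rxyz i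

-- Basic solutions, dual vectors and the effect of a pivot.

module Bases {c ℓ₁ ℓ₂} (F : OrderedField c ℓ₁ ℓ₂) where

  open OrderedField F hiding (zero)
  open OrderedFieldProperties F
  open LP F
  open LinearAlgebra F
  open RingProperties ring
  open SemiringSum semiring using (sum-cong-≋; ∑-distrib-+)
  open StrictPartialOrderReasoning strictPartialOrder

  module _ {n} {a : BlockType n} {W : BlockMatrix a} {p : Vec n} (bases : FeasibleBases W p) where

    open FeasibleBases bases

    basicSolution : Vertex a → Vec n
    basicSolution B = inv B ⊛ p

    basicSolution-solves : ∀ B i → (transpose (W ⟦ B ⟧) ⊛ basicSolution B) i ≈ p i
    basicSolution-solves B = inverse-⊛ (proj₁ (inverse B)) p

    -- Equal vertices give the same linear system, whose solution is unique; this avoids comparing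
    -- the matrices `inv B` and `inv C`.
    basicSolution-cong : ∀ {B C} → B ≐ C → ∀ j → basicSolution B j ≈ basicSolution C j
    basicSolution-cong {B} {C} B≐C = inverse-unique (inverse B) λ i → begin-equality
      sum (λ l → W l (B l) i * basicSolution C l)
        ≈⟨ sum-cong-≋ (λ l → *-congʳ (reflexive (≡.cong (λ k → W l k i) (B≐C l)))) ⟩
      sum (λ l → W l (C l) i * basicSolution C l)  ≈⟨ basicSolution-solves C i ⟩
      p i                                          ∎

    module _ (cost : BlockVector a) where

      value : Vertex a → Carrier
      value B = cost ⟦ B ⟧ ∙ basicSolution B

      value-cong : ∀ {B C} → B ≐ C → value B ≈ value C
      value-cong B≐C = sum-cong-≋ λ j →
        *-cong (reflexive (≡.cong (cost j) (B≐C j))) (basicSolution-cong B≐C j)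

      -- The simplex multipliers of the basis: subtracting `W j i ∙ dual B` from `cost j i` gives
      -- the reduced cost.
      dual : Vertex a → Vec n
      dual B = transpose (inv B) ⊛ cost ⟦ B ⟧

      dual-∙ : ∀ B w → dual B ∙ w ≈ cost ⟦ B ⟧ ∙ (inv B ⊛ w)
      dual-∙ B = ⊛-adjoint (transpose (inv B)) (cost ⟦ B ⟧)

      dual-tight : ∀ B j → W j (B j) ∙ dual B ≈ cost j (B j)
      dual-tight B j = begin-equality
        W j (B j) ∙ dual B                      ≈⟨ ∙-comm (W j (B j)) (dual B) ⟩
        dual B ∙ W j (B j)                      ≈⟨ dual-∙ B (W j (B j)) ⟩
        cost ⟦ B ⟧ ∙ (inv B ⊛ W j (B j))        ≈⟨ ∙-congˡ (cost ⟦ B ⟧) (λ l → proj₂ (inverse B) l j) ⟩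
        cost ⟦ B ⟧ ∙ (λ l → I l j)              ≈⟨ ∙-I j (cost ⟦ B ⟧) ⟩
        cost j (B j)                            ∎

      -- Split each cost into its reduced cost at `B` plus `W l i ∙ dual B`. The second parts add up
      -- to `dual B ∙ p`, because the new basic solution solves the system for `p`. Of the first
      -- parts only block `j` survives, because reduced costs vanish on `B`.
      value-pivot : ∀ B j k →
        value (B [ j ≔ k ]) ≈ basicSolution (B [ j ≔ k ]) j * (cost j k - W j k ∙ dual B) + value B
      value-pivot B j k = begin-equality
        sum (λ l → cost l (C l) * y l)             ≈⟨ sum-cong-≋ split ⟩
        sum (λ l → y l * rc l (C l) + (W ⟦ C ⟧ ⊛ π) l * y l)
          ≈⟨ ∑-distrib-+ (λ l → y l * rc l (C l)) (λ l → (W ⟦ C ⟧ ⊛ π) l * y l) ⟩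
        sum (λ l → y l * rc l (C l)) + (W ⟦ C ⟧ ⊛ π) ∙ y
          ≈⟨ +-cong (sum-single j _ unchanged) (trans (⊛-adjoint (W ⟦ C ⟧) π y) (∙-congˡ π (basicSolution-solves C))) ⟩
        y j * rc j (C j) + π ∙ p
          ≈⟨ +-cong (*-congˡ (reflexive (≡.cong (rc j) (≔-lookup B j k)))) (dual-∙ B p) ⟩
        y j * rc j k + value B                     ∎
        where
        C : Vertex a
        C = B [ j ≔ k ]

        y π : Vec n
        y = basicSolution C
        π = dual B

        rc : BlockVector a
        rc l i = cost l i - W l i ∙ π

        split : ∀ l → cost l (C l) * y l ≈ y l * rc l (C l) + (W ⟦ C ⟧ ⊛ π) l * y l
        split l = begin-equality
          cost l (C l) * y l
            ≈⟨ *-congʳ (//-rightDividesˡ (W l (C l) ∙ π) (cost l (C l))) ⟨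
          (rc l (C l) + W l (C l) ∙ π) * y l                    ≈⟨ distribʳ (y l) (rc l (C l)) (W l (C l) ∙ π) ⟩
          rc l (C l) * y l + W l (C l) ∙ π * y l                ≈⟨ +-congʳ (*-comm (rc l (C l)) (y l)) ⟩
          y l * rc l (C l) + W l (C l) ∙ π * y l                ∎

        unchanged : ∀ l → l ≢ j → y l * rc l (C l) ≈ 0#
        unchanged l l≢j = begin-equality
          y l * rc l (C l)  ≈⟨ *-congˡ (reflexive (≡.cong (rc l) (≔-minimal B l≢j))) ⟩
          y l * rc l (B l)  ≈⟨ *-congˡ (x≈y⇒x∙y⁻¹≈ε (sym (dual-tight B l))) ⟩
          y l * 0#          ≈⟨ zeroʳ (y l) ⟩
          0#                ∎

      -- A pivot with negative reduced cost would decrease the value.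
      leastValue⇒feasible : ∀ B → (∀ C → value B ≤ value C) → ∀ j i → W j i ∙ dual B ≤ cost j i
      leastValue⇒feasible B B-min j i = ≮⇒≥ λ c<wπ → <⇒≱ (decrease c<wπ) (B-min (B [ j ≔ i ]))
        where
        y wπ : Carrier
        y = basicSolution (B [ j ≔ i ]) j
        wπ = W j i ∙ dual B

        decrease : cost j i < wπ → value (B [ j ≔ i ]) < value B
        decrease c<wπ = begin-strict
          value (B [ j ≔ i ])             ≈⟨ value-pivot B j i ⟩
          y * (cost j i - wπ) + value B   <⟨ +-monoˡ-< (value B) (*-pos-neg (positive (B [ j ≔ i ]) j) c-wπ<0) ⟩
          0# + value B                    ≈⟨ +-identityˡ (value B) ⟩
          value B                         ∎
          where
          c-wπ<0 : cost j i - wπ < 0#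
          c-wπ<0 = <-respʳ-≈ (-‿inverseʳ wπ) (+-monoˡ-< (- wπ) c<wπ)

      -- There are finitely many vertices, so a least value is found by search and no termination
      -- argument for pivoting arises. The given vertex makes the search nonempty.
      dualOptimum : Vertex a → ∃[ π ] ∃[ B ] ((∀ j i → W j i ∙ π ≤ cost j i) × π ∙ p ≈ value B)
      dualOptimum B₀ = fromMinimum (vertexMinimum a value value-cong B₀)
        where
        fromMinimum : ∃[ B ] (∀ C → value B ≤ value C) →
                      ∃[ π ] ∃[ B ] ((∀ j i → W j i ∙ π ≤ cost j i) × π ∙ p ≈ value B)
        fromMinimum (B , B-min) = dual B , B , leastValue⇒feasible B B-min , dual-∙ B p

-- The discounted MDP obtained from a witness and a scaling.

module ScaledMDP {c ℓ₁ ℓ₂} (F : OrderedField c ℓ₁ ℓ₂) where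

  open OrderedField F hiding (zero)
  open OrderedFieldProperties F
  open LP F
  open LinearAlgebra F
  open Bases F
  open RingProperties ring
  open SemiringSum semiring using (sum-cong-≋; ∑-distrib-+; *-distribˡ-sum)
  open NaturalCoefficients commutativeSemiring using (solve; _:*_; _:=_)
  open StrictPartialOrderReasoning strictPartialOrder

  module _ {n} {b : BlockType n} (G : GridLP b)
           {X : Matrix n n} {Y : BlockMatrix b} (MX≈Y : GridLP.M G ⊗ᴮ X ≈ᴮᴹ Y)
           {L : BlockVector b} {H : Vec n} (0<L : Positiveᴮ L) (0<H : Positiveⱽ H)
           (stochasticK : IsStochasticK (scaledMatrix L Y H X)) where

    open GridLP G using (M; q; p; cost)
    private
      module G = GridLP G

      W : BlockMatrix (b +𝟏)
      W = [ M ∣ I ]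

      δ : BlockVector (b +𝟏)
      δ = [ L ∣ (λ j → H j ⁻¹) ]

      0<δ : Positiveᴮ δ
      0<δ j = append-zip (λ d _ _ → 0# < d) {v = L j} {w = L j} {y = H j} {z = H j}
        (0<L j) (⁻¹-pos (0<H j))

      γ : Carrier
      γ = proj₁ stochasticK

      γ<1 : γ < 1#
      γ<1 = proj₁ (proj₂ (proj₂ stochasticK))

      -- The stochastic matrices are given per representative submatrix, so a single row is read off
      -- from a submatrix through it; the other blocks take the default index `zero`.
      vertex : ∀ j → Fin ((b +𝟏) j) → Vertex (b +𝟏)
      vertex j i = (λ _ → zero) [ j ≔ i ]

      S : Vertex (b +𝟏) → Matrix n n
      S B = proj₁ (proj₂ (proj₂ (proj₂ stochasticK)) B)

      S-stochastic : ∀ B → IsStochastic (S B)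
      S-stochastic B = proj₁ (proj₂ (proj₂ (proj₂ (proj₂ stochasticK)) B))

      P Q : BlockMatrix (b +𝟏)
      P j i = S (vertex j i) j
      Q j i k = I j k - γ * P j i k

      P-nonneg : ∀ j i k → 0# ≤ P j i k
      P-nonneg j i = proj₁ (S-stochastic (vertex j i)) j

      P-sum : ∀ j i → sum (P j i) ≈ 1#
      P-sum j i = proj₂ (S-stochastic (vertex j i)) j

      0≤γ : 0# ≤ γ
      0≤γ = proj₁ (proj₂ stochasticK)

      Q≈scaledMatrix : Q ≈ᴮᴹ scaledMatrix L Y H X
      -- Block `j` of `vertex j i` is `i` only up to the equation `≔-lookup`, hence the transport.
      Q≈scaledMatrix j i k = ≡.subst (λ i′ → Q j i k ≈ scaledMatrix L Y H X j i′ k)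
        (≔-lookup (λ _ → zero) j i)
        (sym (proj₂ (proj₂ (proj₂ (proj₂ (proj₂ stochasticK)) (vertex j i))) j k))

      -- On the rows of M this is LY = L(MX); on the appended rows it is H⁻¹X = H⁻¹(IX).
      Q≈δWX : ∀ j i k → Q j i k ≈ δ j i * (W j i ∙ λ l → X l k)
      Q≈δWX j i k = trans (Q≈scaledMatrix j i k)
        (append-zip (λ s d w → s k ≈ d * (w ∙ λ l → X l k)) {u = (L ⊗ᴰᴮ Y) j} {x = (H ⁻¹⊗ᴰ X) j}
          (λ i → *-congˡ (sym (MX≈Y j i k))) (*-congˡ (sym (I-∙ j λ l → X l k))) i)

      Q-Z : ∀ B → IsZ (transpose (Q ⟦ B ⟧))
      Q-Z B i j i≢j = begin
        I j i - γ * P j (B j) i   ≈⟨ +-congʳ (I-off (i≢j ∘ ≡.sym)) ⟩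
        0# - γ * P j (B j) i      ≈⟨ +-identityˡ _ ⟩
        - (γ * P j (B j) i)       ≤⟨ -‿nonneg (*-nonneg 0≤γ (P-nonneg j (B j) i)) ⟩
        0#                        ∎

      Q-rowSum : ∀ j i → Q j i ∙ (λ _ → 1#) ≈ 1# - γ
      Q-rowSum j i = begin-equality
        sum (λ k → Q j i k * 1#)                                ≈⟨ sum-cong-≋ (λ k → *-identityʳ (Q j i k)) ⟩
        sum (λ k → I j k - γ * P j i k)                         ≈⟨ ∑-distrib-+ (I j) (λ k → - (γ * P j i k)) ⟩
        sum (I j) + sum (λ k → - (γ * P j i k))                 ≈⟨ +-cong (sum-I j) (sum-neg (λ k → γ * P j i k)) ⟩
        1# - sum (λ k → γ * P j i k)                            ≈⟨ +-congˡ (-‿cong (sym (*-distribˡ-sum γ (P j i)))) ⟩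
        1# - γ * sum (P j i)
          ≈⟨ +-congˡ (-‿cong (trans (*-congˡ (P-sum j i)) (*-identityʳ γ))) ⟩
        1# - γ                                                  ∎

      -- The row sums of Q_B are 1 - γ > 0, so the all-ones vector is a valid certificate for
      -- `solveZ` on the transpose.
      Q-invertible : ∀ B → ∃[ A ] IsInverse (transpose (Q ⟦ B ⟧)) A
      Q-invertible B = solvable⇒invertible (solveZ (transpose (Q ⟦ B ⟧)) (Q-Z B) (λ _ → 1#) (λ _ → 0<1)
        (λ j → <-respʳ-≈ (sym (Q-rowSum j (B j))) (x<y⇒0<y-x γ<1)))

      Q-inv : Vertex (b +𝟏) → Matrix n n
      Q-inv B = proj₁ (Q-invertible B)

      -- The transpose of Q_B factors as XᵀW_Bᵀ followed on the right by the diagonal of δ_B. Taking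
      -- `w` to be `p` gives the basic solutions; taking a scaled row of `W` gives the reduced
      -- costs.
      Q-inv-⊛ : ∀ B {v w} → (∀ i → (transpose (W ⟦ B ⟧) ⊛ v) i ≈ w i) →
                ∀ j → (Q-inv B ⊛ (transpose X ⊛ w)) j ≈ δ j (B j) ⁻¹ * v j
      Q-inv-⊛ B {v} {w} Wᵀv≈w = inverse-unique (proj₂ (Q-invertible B)) λ k → begin-equality
        sum (λ l → Q l (B l) k * (δ l (B l) ⁻¹ * v l))         ≈⟨ sum-cong-≋ (unscale k) ⟩
        (W ⟦ B ⟧ ⊛ (λ i → X i k)) ∙ v                          ≈⟨ ⊛-adjoint (W ⟦ B ⟧) (λ i → X i k) v ⟩
        (λ i → X i k) ∙ (transpose (W ⟦ B ⟧) ⊛ v)              ≈⟨ ∙-congˡ (λ i → X i k) Wᵀv≈w ⟩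
        (transpose X ⊛ w) k                                    ∎
        where
        unscale : ∀ k l → Q l (B l) k * (δ l (B l) ⁻¹ * v l) ≈ (W l (B l) ∙ λ i → X i k) * v l
        unscale k l = begin-equality
          Q l (B l) k * (d ⁻¹ * v l)     ≈⟨ *-congʳ (Q≈δWX l (B l) k) ⟩
          d * e * (d ⁻¹ * v l)
            ≈⟨ solve 4 (λ d e d′ v → d :* e :* (d′ :* v) := d :* d′ :* (e :* v)) refl d e (d ⁻¹) (v l) ⟩
          d * d ⁻¹ * (e * v l)           ≈⟨ *-congʳ (*-⁻¹ (0<δ l (B l))) ⟩
          1# * (e * v l)                 ≈⟨ *-identityˡ (e * v l) ⟩
          e * v l                        ∎
          where
          d e : Carrier
          d = δ l (B l)
          e = W l (B l) ∙ λ i → X i k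

    scaledMDP : DiscountedMDP (b +𝟏)
    scaledMDP = record
      { actions  = λ j → ℕ.s≤s ℕ.z≤n
      ; r        = λ j i → - [ (λ l k → q l k * L l k) ∣ 𝟘 ] j i
      ; P        = P
      ; P-nonneg = P-nonneg
      ; P-sum    = P-sum
      ; γ        = γ
      ; 0≤γ      = 0≤γ
      ; γ<1      = γ<1
      ; g        = transpose X ⊛ p
      ; bases    = record
        { inv      = Q-inv
        ; inverse  = λ B → proj₂ (Q-invertible B)
        ; positive = λ B j → <-respʳ-≈ (sym (Q-inv-⊛ B (basicSolution-solves G.bases B) j))
                               (*-pos (⁻¹-pos (0<δ j (B j))) (G.positive B j))
        }
      }

    private
      module D = DiscountedMDP scaledMDP

    scaledMDP-isScaledMDPOf : IsScaledMDPOf G X Y L H scaledMDP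
    scaledMDP-isScaledMDPOf = (λ j i → refl) , Q≈scaledMatrix , (λ k → refl)

    -- On the appended entries the cost is 0, so any scaling factor agrees with the reward 0 there.
    r≈-δcost : ∀ j i → D.r j i ≈ - (δ j i * cost j i)
    r≈-δcost j i = -‿cong (append-zip (λ x d e → x ≈ d * e)
      (λ i → *-comm (q j i) (L j i)) (sym (zeroʳ (H j ⁻¹))) i)

    -- The factors δ in the rewards of `B` cancel against their inverses in the coordinates of the
    -- entering row, leaving the factor `δ j k` of that row alone.
    reducedCost-scaled : ∀ B j k → D.reducedCost B j k ≈ δ j k * G.reducedCost B j k
    reducedCost-scaled B j k = begin-equality
      - D.r j k + D.r ⟦ B ⟧ ∙ (Q-inv B ⊛ Q j k)
        ≈⟨ +-cong (trans (-‿cong (r≈-δcost j k)) (-‿involutive _)) basic ⟩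
      δ j k * cost j k + δ j k * - (cost ⟦ B ⟧ ∙ s)          ≈⟨ distribˡ (δ j k) (cost j k) (- (cost ⟦ B ⟧ ∙ s)) ⟨
      δ j k * G.reducedCost B j k                            ∎
      where
      s : Vec n
      s = G.inv B ⊛ W j k

      δs : Vec n
      δs l = δ l (B l) ⁻¹ * (δ j k * s l)

      Q-inv-Q : ∀ l → (Q-inv B ⊛ Q j k) l ≈ δs l
      Q-inv-Q l = begin-equality
        (Q-inv B ⊛ Q j k) l
          ≈⟨ ∙-congˡ (Q-inv B l) (λ i → trans (Q≈δWX j k i) (trans (*-congˡ (∙-comm (W j k) (λ l → X l i))) (sym (∙-scaleʳ (δ j k) (λ l → X l i) (W j k))))) ⟩
        (Q-inv B ⊛ (transpose X ⊛ (λ i → δ j k * W j k i))) l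
          ≈⟨ Q-inv-⊛ B (λ i → trans (∙-scaleʳ (δ j k) (transpose (W ⟦ B ⟧) i) s) (*-congˡ (inverse-⊛ (proj₁ (G.inverse B)) (W j k) i))) l ⟩
        δs l                                             ∎

      basic : D.r ⟦ B ⟧ ∙ (Q-inv B ⊛ Q j k) ≈ δ j k * - (cost ⟦ B ⟧ ∙ s)
      basic = begin-equality
        D.r ⟦ B ⟧ ∙ (Q-inv B ⊛ Q j k)                    ≈⟨ sum-cong-≋ term ⟩
        sum (λ l → cost l (B l) * (δ j k * - s l))       ≈⟨ ∙-scaleʳ (δ j k) (cost ⟦ B ⟧) (λ l → - s l) ⟩
        δ j k * (cost ⟦ B ⟧ ∙ (λ l → - s l))             ≈⟨ *-congˡ (∙-negʳ (cost ⟦ B ⟧) s) ⟩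
        δ j k * - (cost ⟦ B ⟧ ∙ s)                       ∎
        where
        term : ∀ l → D.r l (B l) * (Q-inv B ⊛ Q j k) l ≈ cost l (B l) * (δ j k * - s l)
        term l = begin-equality
          D.r l (B l) * (Q-inv B ⊛ Q j k) l              ≈⟨ *-cong (r≈-δcost l (B l)) (Q-inv-Q l) ⟩
          - (d * e) * (d ⁻¹ * (δ j k * s l))             ≈⟨ -‿distribˡ-* (d * e) (d ⁻¹ * (δ j k * s l)) ⟨
          - (d * e * (d ⁻¹ * (δ j k * s l)))
            ≈⟨ -‿cong (solve 5 (λ d e d′ f s → d :* e :* (d′ :* (f :* s)) := d :* d′ :* (e :* f :* s)) refl d e (d ⁻¹) (δ j k) (s l)) ⟩
          - (d * d ⁻¹ * (e * δ j k * s l))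
            ≈⟨ -‿cong (trans (*-congʳ (*-⁻¹ (0<δ l (B l)))) (*-identityˡ (e * δ j k * s l))) ⟩
          - (e * δ j k * s l)                            ≈⟨ -‿distribʳ-* (e * δ j k) (s l) ⟩
          e * δ j k * - s l                              ≈⟨ *-assoc e (δ j k) (- s l) ⟩
          e * (δ j k * - s l)                            ∎
          where
          d e : Carrier
          d = δ l (B l)
          e = cost l (B l)

    scaledMDP-≋ : G._⟶_ ≋ D._⟶_
    scaledMDP-≋ B C = mk⇔
      (λ (j , B≢C , rc<0) → j , B≢C ,
        <-respˡ-≈ (sym (reducedCost-scaled B j (C j))) (*-pos-neg (0<δ j (C j)) rc<0))
      (λ (j , B≢C , rc<0) → j , B≢C ,
        *-pos-neg-cancelˡ (0<δ j (C j)) (<-respˡ-≈ (reducedCost-scaled B j (C j)) rc<0))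

-- Existence of a proper hidden K-witness and of a stochastic scaling.

module HiddenKWitness {c ℓ₁ ℓ₂} (F : OrderedField c ℓ₁ ℓ₂) where

  open OrderedField F hiding (zero)
  open OrderedFieldProperties F
  open LP F
  open LinearAlgebra F
  open Bases F
  open RingProperties ring
  open SemiringSum semiring using (sum-cong-≋; ∑-distrib-+; *-distribˡ-sum)
  open NaturalCoefficients commutativeSemiring using (solve; _:*_; _:=_)
  open StrictPartialOrderReasoning strictPartialOrder

  WX≈[MX∣X] : ∀ {n} {b : BlockType n} (M : BlockMatrix b) (X : Matrix n n) →
              [ M ∣ I ] ⊗ᴮ X ≈ᴮᴹ [ M ⊗ᴮ X ∣ X ]
  WX≈[MX∣X] M X j i k =
    append-zip (λ w v _ → (w ∙ λ l → X l k) ≈ v k)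
      {u = M j} {v = (M ⊗ᴮ X) j} {w = M j} {x = I j} {y = X j} {z = I j}
      (λ i → refl) (I-∙ j λ l → X l k) i

  module _ {n} {b : BlockType n} (G : GridLP b) where

    open GridLP G using (M; p; bases; positive)

    private
      W : BlockMatrix (b +𝟏)
      W = [ M ∣ I ]

      -- The slack basis: its rows of `W` form the identity, so its basic solution is `p`, and
      -- multiplying by them reads off the entries of a vector.
      last : Vertex (b +𝟏)
      last j = fromℕ (b j)

      W-last : ∀ j k → W j (last j) k ≈ I j k
      W-last j k = reflexive (≡.cong (λ w → w k) (insertAt-lookup (M j) (last j) (I j)))

      W-last-∙ : ∀ j v → W j (last j) ∙ v ≈ v j
      W-last-∙ j v = trans (∙-congʳ v (W-last j)) (I-∙ j v)

      0<p : Positiveⱽ p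
      0<p k = <-respʳ-≈ (begin-equality
        y k                               ≈⟨ ∙-I k y ⟨
        y ∙ (λ l → I l k)                 ≈⟨ ∙-congˡ y (λ l → W-last l k) ⟨
        y ∙ (λ l → W l (last l) k)        ≈⟨ ∙-comm y (λ l → W l (last l) k) ⟩
        (transpose (W ⟦ last ⟧) ⊛ y) k    ≈⟨ basicSolution-solves bases last k ⟩
        p k                               ∎) (positive last k)
        where
        y : Vec n
        y = basicSolution bases last

      optimum : (cost : BlockVector (b +𝟏)) →
                ∃[ π ] ∃[ B ] ((∀ j i → W j i ∙ π ≤ cost j i) × π ∙ p ≈ value bases cost B)
      optimum cost = dualOptimum bases cost last

      -- Column k separates p from the cone spanned by the blocks other than k.
      X₀ : Matrix n n
      X₀ i k = proj₁ (optimum (λ j _ → I j k)) i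

      WX₀≤I : ∀ j i k → W j i ∙ (λ l → X₀ l k) ≤ I j k
      WX₀≤I j i k = proj₁ (proj₂ (proj₂ (optimum (λ j _ → I j k)))) j i

      -- With the indicator of block `k` as cost, the value of a vertex is its basic variable in
      -- block `k`, which is positive.
      0<X₀ᵀp : Positiveⱽ (transpose X₀ ⊛ p)
      0<X₀ᵀp k = <-respʳ-≈ (begin-equality
        y k                                       ≈⟨ ∙-I k y ⟨
        y ∙ (λ l → I l k)                         ≈⟨ ∙-comm y (λ l → I l k) ⟩
        value bases (λ j _ → I j k) B             ≈⟨ proj₂ (proj₂ (proj₂ (optimum (λ j _ → I j k)))) ⟨
        (transpose X₀ ⊛ p) k                      ∎) (positive B k)
        where
        B : Vertex (b +𝟏)
        B = proj₁ (proj₂ (optimum (λ j _ → I j k)))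

        y : Vec n
        y = basicSolution bases B

      X₀-Z : IsZ X₀
      X₀-Z j k j≢k = begin
        X₀ j k                               ≈⟨ W-last-∙ j (λ l → X₀ l k) ⟨
        W j (last j) ∙ (λ l → X₀ l k)        ≤⟨ WX₀≤I j (last j) k ⟩
        I j k                                ≈⟨ I-off j≢k ⟩
        0#                                   ∎

      z : Vec n
      z i = - proj₁ (optimum (λ _ _ → - 1#)) i

      0<Wz : ∀ j i → 0# < W j i ∙ z
      0<Wz j i = <-respʳ-≈ (sym (∙-negʳ (W j i) π)) (-‿neg (begin-strict
        W j i ∙ π    ≤⟨ proj₁ (proj₂ (proj₂ (optimum (λ _ _ → - 1#)))) j i ⟩
        - 1#         ≈⟨ +-identityˡ (- 1#) ⟨
        0# - 1#      <⟨ +-monoˡ-< (- 1#) 0<1 ⟩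
        1# - 1#      ≈⟨ -‿inverseʳ 1# ⟩
        0#           ∎))
        where
        π : Vec n
        π = proj₁ (optimum (λ _ _ → - 1#))

      module α = Solution (solveZ X₀ X₀-Z p 0<p 0<X₀ᵀp z)

      0<α : Positiveⱽ α.x
      -- The right-hand side `z` is positive because its entries are those of W z on the slack rows.
      0<α = α.positive λ j → <-respʳ-≈ (W-last-∙ j z) (0<Wz j (last j))

      X : Matrix n n
      X i k = α.x k * X₀ i k

      WX : BlockMatrix (b +𝟏)
      WX = W ⊗ᴮ X

      WX-offDiagonal : ∀ j i k → j ≢ k → WX j i k ≤ 0#
      WX-offDiagonal j i k j≢k = begin
        WX j i k                                  ≈⟨ ∙-scaleʳ (α.x k) (W j i) (λ l → X₀ l k) ⟩
        α.x k * (W j i ∙ (λ l → X₀ l k))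
          ≤⟨ *-nonneg-nonpos (inj₁ (0<α k)) (≤-trans (WX₀≤I j i k) (inj₂ (I-off j≢k))) ⟩
        0#                                        ∎

      0<WX-rowSum : ∀ j i → 0# < sum (WX j i)
      0<WX-rowSum j i = <-respʳ-≈ (begin-equality
        W j i ∙ z                                       ≈⟨ ∙-congˡ (W j i) α.solves ⟨
        W j i ∙ (X₀ ⊛ α.x)                              ≈⟨ ⊛-⊗ (W j) X₀ α.x i ⟩
        sum (λ k → (W j i ∙ λ l → X₀ l k) * α.x k)
          ≈⟨ sum-cong-≋ (λ k → trans (*-comm (W j i ∙ λ l → X₀ l k) (α.x k)) (sym (∙-scaleʳ (α.x k) (W j i) (λ l → X₀ l k)))) ⟩
        sum (WX j i)                                    ∎) (0<Wz j i)

      Y : BlockMatrix b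
      Y = M ⊗ᴮ X

      -- The sign conditions are proved uniformly for `WX`, without separating slack rows, and then
      -- carried over to Y and X.
      WX≈[Y∣X] : WX ≈ᴮᴹ [ Y ∣ X ]
      WX≈[Y∣X] = WX≈[MX∣X] M X

      [Y∣X]-offDiagonal : ∀ j i k → j ≢ k → [ Y ∣ X ] j i k ≤ 0#
      [Y∣X]-offDiagonal j i k j≢k = ≤-trans (inj₂ (sym (WX≈[Y∣X] j i k))) (WX-offDiagonal j i k j≢k)

      Y-Z : IsBlockZ Y
      -- `punchIn (last j)` embeds the original indices of block `j` into the extended block.
      Y-Z B j k j≢k = ≤-trans
        (inj₂ (reflexive (≡.cong (λ v → v k) (≡.sym (insertAt-punchIn (Y j) (last j) (X j) (B j))))))
        ([Y∣X]-offDiagonal j (punchIn (last j) (B j)) k j≢k)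

      X-Z : IsZ X
      X-Z j k j≢k = ≤-trans
        (inj₂ (reflexive (≡.cong (λ v → v k) (≡.sym (insertAt-lookup (Y j) (last j) (X j))))))
        ([Y∣X]-offDiagonal j (last j) k j≢k)

    hiddenKWitness : ∃[ X ] ∃[ Y ] IsProperHiddenKWitness M X Y
    hiddenKWitness = X , Y , X-Z , Y-Z , (λ j i k → refl) ,
      λ j i → <-respʳ-≈ (sum-cong-≋ (WX≈[Y∣X] j i)) (0<WX-rowSum j i)

  -- Take γ = 1 - ε and S = γ⁻¹(I - Q_B). The bounds on the entries of `Q` make S nonnegative, and
  -- its row sums are γ⁻¹(1 - ε) = 1.
  rowSum-ε⇒stochasticK : ∀ {n} {a : BlockType n} (Q : BlockMatrix a) {ε} → 0# < ε → ε < 1# →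
    (∀ j i k → j ≢ k → Q j i k ≤ 0#) → (∀ j i → Q j i j ≤ 1#) → (∀ j i → sum (Q j i) ≈ ε) →
    IsStochasticK Q
  rowSum-ε⇒stochasticK {n} Q {ε} 0<ε ε<1 Q-Z Q-diag Q-sum =
    γ , inj₁ 0<γ , γ<1 , λ B → S B , (S-nonneg B , S-sum B) , Q≈I-γS B
    where
    γ : Carrier
    γ = 1# - ε

    0<γ : 0# < γ
    0<γ = x<y⇒0<y-x ε<1

    γ<1 : γ < 1#
    γ<1 = begin-strict
      1# - ε        ≈⟨ +-identityˡ (1# - ε) ⟨
      0# + (1# - ε) <⟨ +-monoˡ-< (1# - ε) 0<ε ⟩
      ε + (1# - ε)  ≈⟨ +-comm ε (1# - ε) ⟩
      1# - ε + ε    ≈⟨ //-rightDividesˡ ε 1# ⟩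
      1#            ∎

    S : Vertex _ → Matrix n n
    S B j k = γ ⁻¹ * (I j k - Q j (B j) k)

    S-nonneg : ∀ B j k → 0# ≤ S B j k
    S-nonneg B j k = *-nonneg (inj₁ (⁻¹-pos 0<γ)) (x≤y⇒0≤y-x (Q≤I (j ≟ k)))
      where
      Q≤I : Dec (j ≡ k) → Q j (B j) k ≤ I j k
      Q≤I (yes ≡.refl) = ≤-trans (Q-diag j (B j)) (inj₂ (sym (I-diag j)))
      Q≤I (no j≢k)     = ≤-trans (Q-Z j (B j) k j≢k) (inj₂ (sym (I-off j≢k)))

    S-sum : ∀ B j → sum (S B j) ≈ 1#
    S-sum B j = begin-equality
      sum (S B j)                                        ≈⟨ *-distribˡ-sum (γ ⁻¹) (λ k → I j k - Q j (B j) k) ⟨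
      γ ⁻¹ * sum (λ k → I j k - Q j (B j) k)             ≈⟨ *-congˡ (∑-distrib-+ (I j) (λ k → - Q j (B j) k)) ⟩
      γ ⁻¹ * (sum (I j) + sum (λ k → - Q j (B j) k))
        ≈⟨ *-congˡ (+-cong (sum-I j) (trans (sum-neg (Q j (B j))) (-‿cong (Q-sum j (B j))))) ⟩
      γ ⁻¹ * γ                                           ≈⟨ ⁻¹-* 0<γ ⟩
      1#                                                 ∎

    Q≈I-γS : ∀ B j k → Q j (B j) k ≈ I j k - γ * S B j k
    Q≈I-γS B j k = begin-equality
      x                                  ≈⟨ +-identityˡ x ⟨
      0# + x                             ≈⟨ +-congʳ (-‿inverseʳ (I j k)) ⟨
      I j k - I j k + x                  ≈⟨ +-assoc (I j k) (- I j k) x ⟩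
      I j k + (- I j k + x)              ≈⟨ +-congˡ (trans (+-comm (- I j k) x) (sym (⁻¹-anti-homo‿- (I j k) x))) ⟩
      I j k - (I j k - x)                ≈⟨ +-congˡ (-‿cong (*-identityˡ (I j k - x))) ⟨
      I j k - 1# * (I j k - x)           ≈⟨ +-congˡ (-‿cong (*-congʳ (*-⁻¹ 0<γ))) ⟨
      I j k - γ * γ ⁻¹ * (I j k - x)     ≈⟨ +-congˡ (-‿cong (*-assoc γ (γ ⁻¹) (I j k - x))) ⟩
      I j k - γ * S B j k                ∎
      where
      x : Carrier
      x = Q j (B j) k

  -- Each row of [ Y ∣ X ] is divided by its sum and by a common t that exceeds
  -- 1 and every quotient of a diagonal entry by its row sum.
  stochasticScaling : ∀ {n} {b : BlockType n} → Vertex b →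
    ∀ {M : BlockMatrix b} {X : Matrix n n} {Y : BlockMatrix b} → IsProperHiddenKWitness M X Y →
    ∃[ L ] ∃[ H ] (Positiveᴮ {b = b} L × Positiveⱽ H × IsStochasticK (scaledMatrix L Y H X))
  stochasticScaling {n} {b} B₀ {M} {X} {Y} (X-Z , Y-Z , _ , 0<sum) =
    L , H , 0<L , 0<H , rowSum-ε⇒stochasticK Q 0<ε ε<1 Q-offDiagonal Q-diagonal Q-rowSum
    where
    V : BlockMatrix (b +𝟏)
    V = [ Y ∣ X ]

    σ : BlockVector (b +𝟏)
    σ j i = sum (V j i)

    V-offDiagonal : ∀ j i k → j ≢ k → V j i k ≤ 0#
    V-offDiagonal j i k j≢k = append-zip (λ v _ _ → v k ≤ 0#)
      {u = Y j} {v = Y j} {w = Y j} {x = X j} {y = X j} {z = X j}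
      -- `Y-Z` speaks of whole representative submatrices, so `B₀` is redirected to pass through the
      -- row in question.
      (λ i → ≡.subst (λ i′ → Y j i′ k ≤ 0#) (≔-lookup B₀ j i) (Y-Z (B₀ [ j ≔ i ]) j k j≢k))
      (X-Z j k j≢k) i

    bounds : ∀ j → ∃[ t ] (1# < t × (∀ i → V j i j * σ j i ⁻¹ ≤ t))
    bounds j = upperBound (λ i → V j i j * σ j i ⁻¹)

    bound : ∃[ t ] (1# < t × (∀ j → proj₁ (bounds j) ≤ t))
    bound = upperBound (proj₁ ∘ bounds)

    t ε : Carrier
    t = proj₁ bound
    ε = t ⁻¹

    1<t : 1# < t
    1<t = proj₁ (proj₂ bound)

    0<t : 0# < t
    0<t = <-trans 0<1 1<t

    Vσ⁻¹≤t : ∀ j i → V j i j * σ j i ⁻¹ ≤ t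
    Vσ⁻¹≤t j i = ≤-trans (proj₂ (proj₂ (bounds j)) i) (proj₂ (proj₂ bound) j)

    0<ε : 0# < ε
    0<ε = ⁻¹-pos 0<t

    ε<1 : ε < 1#
    ε<1 = begin-strict
      ε                   ≈⟨ +-identityˡ ε ⟨
      0# + ε              <⟨ +-monoˡ-< ε (*-pos 0<ε (x<y⇒0<y-x 1<t)) ⟩
      ε * (t - 1#) + ε    ≈⟨ +-congˡ (*-identityʳ ε) ⟨
      ε * (t - 1#) + ε * 1#  ≈⟨ distribˡ ε (t - 1#) 1# ⟨
      ε * (t - 1# + 1#)   ≈⟨ *-congˡ (//-rightDividesˡ 1# t) ⟩
      ε * t               ≈⟨ ⁻¹-* 0<t ⟩
      1#                  ∎

    0<sumY : ∀ j i → 0# < sum (Y j i)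
    0<sumY j i = <-respʳ-≈
      (reflexive (≡.cong sum (insertAt-punchIn (Y j) (fromℕ (b j)) (X j) i))) (0<sum j (punchIn (fromℕ (b j)) i))

    0<sumX : ∀ j → 0# < sum (X j)
    0<sumX j = <-respʳ-≈
      (reflexive (≡.cong sum (insertAt-lookup (Y j) (fromℕ (b j)) (X j)))) (0<sum j (fromℕ (b j)))

    L : BlockVector b
    L j i = ε * sum (Y j i) ⁻¹

    H : Vec n
    -- `scaledMatrix` inverts `H`, so this is the reciprocal of the kind of factor used in `L`.
    H j = t * sum (X j)

    0<L : Positiveᴮ L
    0<L j i = *-pos 0<ε (⁻¹-pos (0<sumY j i))

    0<H : Positiveⱽ H
    0<H j = *-pos 0<t (0<sumX j)

    H⁻¹ : ∀ j → H j ⁻¹ ≈ ε * sum (X j) ⁻¹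
    H⁻¹ j = *-cancelˡ (0<H j) (begin-equality
      t * s * (t * s) ⁻¹       ≈⟨ *-⁻¹ (0<H j) ⟩
      1#                       ≈⟨ *-identityˡ 1# ⟨
      1# * 1#                  ≈⟨ *-cong (*-⁻¹ 0<t) (*-⁻¹ (0<sumX j)) ⟨
      t * ε * (s * s ⁻¹)       ≈⟨ solve 4 (λ t ε s s′ → t :* ε :* (s :* s′) := t :* s :* (ε :* s′)) refl t ε s (s ⁻¹) ⟩
      t * s * (ε * s ⁻¹)       ∎)
      where
      s : Carrier
      s = sum (X j)

    Q : BlockMatrix (b +𝟏)
    Q = scaledMatrix L Y H X

    Q≈ : ∀ j i k → Q j i k ≈ ε * σ j i ⁻¹ * V j i k
    Q≈ j i k = append-zip (λ q v _ → q k ≈ ε * sum v ⁻¹ * v k)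
      {u = (L ⊗ᴰᴮ Y) j} {v = Y j} {w = Y j} {x = (H ⁻¹⊗ᴰ X) j} {y = X j} {z = X j}
      (λ i → refl) (*-congʳ (H⁻¹ j)) i

    0<εσ⁻¹ : ∀ j i → 0# < ε * σ j i ⁻¹
    0<εσ⁻¹ j i = *-pos 0<ε (⁻¹-pos (0<sum j i))

    Q-offDiagonal : ∀ j i k → j ≢ k → Q j i k ≤ 0#
    Q-offDiagonal j i k j≢k = begin
      Q j i k                  ≈⟨ Q≈ j i k ⟩
      ε * σ j i ⁻¹ * V j i k   ≤⟨ *-nonneg-nonpos (inj₁ (0<εσ⁻¹ j i)) (V-offDiagonal j i k j≢k) ⟩
      0#                       ∎

    Q-diagonal : ∀ j i → Q j i j ≤ 1#
    Q-diagonal j i = begin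
      Q j i j                    ≈⟨ Q≈ j i j ⟩
      ε * σ j i ⁻¹ * V j i j     ≈⟨ trans (*-assoc ε (σ j i ⁻¹) (V j i j)) (*-congˡ (*-comm (σ j i ⁻¹) (V j i j))) ⟩
      ε * (V j i j * σ j i ⁻¹)   ≤⟨ *-monoˡ-≤-nonneg (inj₁ 0<ε) (Vσ⁻¹≤t j i) ⟩
      ε * t                      ≈⟨ ⁻¹-* 0<t ⟩
      1#                         ∎

    Q-rowSum : ∀ j i → sum (Q j i) ≈ ε
    Q-rowSum j i = begin-equality
      sum (Q j i)                              ≈⟨ sum-cong-≋ (Q≈ j i) ⟩
      sum (λ k → ε * σ j i ⁻¹ * V j i k)       ≈⟨ *-distribˡ-sum (ε * σ j i ⁻¹) (V j i) ⟨
      ε * σ j i ⁻¹ * σ j i                     ≈⟨ *-assoc ε (σ j i ⁻¹) (σ j i) ⟩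
      ε * (σ j i ⁻¹ * σ j i)                   ≈⟨ *-congˡ (⁻¹-* (0<sum j i)) ⟩
      ε * 1#                                   ≈⟨ *-identityʳ ε ⟩
      ε                                        ∎

-- From Grid-LPs and their witnesses to arbitrary LP-USOs.

open LP

theorem5p4 : ∀ {c ℓ₁ ℓ₂ o} (F : OrderedField c ℓ₁ ℓ₂) (n : ℕ) (b : BlockType n) → PositiveType b →
    (∀ (U : Rel (Vertex (b +𝟏)) o) → IsLPUSO F U →
    ∃ λ (D : DiscountedMDP F (b +𝟏)) → U ≋ DiscountedMDP._⟶_ D)
    ×
    (∀ (G : GridLP F b) → GridLP.DualNondegenerate G →
    ∀ (X : Matrix F n n) (Y : BlockMatrix F b) → IsProperHiddenKWitness F (GridLP.M G) X Y →
    ∀ (L : BlockVector F b) (H : Vec F n) → Positiveᴮ F L → Positiveⱽ F H →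
    IsStochasticK F (scaledMatrix F L Y H X) →
    ∃ λ (D : DiscountedMDP F (b +𝟏)) →
    IsScaledMDPOf F G X Y L H D × (GridLP._⟶_ G ≋ DiscountedMDP._⟶_ D))
theorem5p4 {o = o} F n b 0<b = everyLPUSO , scaled
  where
  open ScaledMDP F
  open HiddenKWitness F

  scaled : ∀ (G : GridLP F b) → GridLP.DualNondegenerate G →
    ∀ (X : Matrix F n n) (Y : BlockMatrix F b) → IsProperHiddenKWitness F (GridLP.M G) X Y →
    ∀ (L : BlockVector F b) (H : Vec F n) → Positiveᴮ F L → Positiveⱽ F H →
    IsStochasticK F (scaledMatrix F L Y H X) →
    ∃ λ (D : DiscountedMDP F (b +𝟏)) →
    IsScaledMDPOf F G X Y L H D × (GridLP._⟶_ G ≋ DiscountedMDP._⟶_ D)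
  scaled G _ X Y (_ , _ , MX≈Y , _) L H 0<L 0<H K =
    scaledMDP G {X} {Y} MX≈Y {L} {H} 0<L 0<H K ,
    scaledMDP-isScaledMDPOf G {X} {Y} MX≈Y {L} {H} 0<L 0<H K ,
    scaledMDP-≋ G {X} {Y} MX≈Y {L} {H} 0<L 0<H K

  everyGridLP : ∀ (G : GridLP F b) → GridLP.DualNondegenerate G →
    (∃[ X ] ∃[ Y ] IsProperHiddenKWitness F (GridLP.M G) X Y) →
    ∃ λ (D : DiscountedMDP F (b +𝟏)) → GridLP._⟶_ G ≋ DiscountedMDP._⟶_ D
  everyGridLP G nondegenerate (X , Y , witness) =
    -- Each block of `b` is nonempty, so choosing its first row gives the required vertex.
    fromScaling (stochasticScaling (λ j → fromℕ< (0<b j)) {M = GridLP.M G} {X} {Y} witness)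
    where
    fromScaling : (∃[ L ] ∃[ H ] (Positiveᴮ F {b = b} L × Positiveⱽ F H × IsStochasticK F (scaledMatrix F L Y H X))) →
                  ∃ λ (D : DiscountedMDP F (b +𝟏)) → GridLP._⟶_ G ≋ DiscountedMDP._⟶_ D
    fromScaling (L , H , 0<L , 0<H , K) =
      map₂ proj₂ (scaled G nondegenerate X Y witness L H 0<L 0<H K)

  everyLPUSO : ∀ (U : Rel (Vertex (b +𝟏)) o) → IsLPUSO F U →
    ∃ λ (D : DiscountedMDP F (b +𝟏)) → U ≋ DiscountedMDP._⟶_ D
  everyLPUSO U (_ , G , nondegenerate , U≋G) =
    map₂ (λ G≋D B C → G≋D B C ⇔-∘ U≋G B C) (everyGridLP G nondegenerate (hiddenKWitness G))
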